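{- Let $\mathcal{H}$ be a hereditary $3$-graph property. If $\overline{H}(k)\in\mathrm{Trip}(\mathcal{H})$ for every $k\geq1$, then $\mathcal{H}$ requires non-zero $\mathrm{vdisc}_3$-error, i.e. $\mathcal{H}$ does not admit zero $\mathrm{vdisc}_3$-error.
   Context: For distinct $x,y,z$ write $xyz=\{x,y,z\}$; $[n]=\{1,\dots,n\}$; $K_3[X,Y,Z]=\{xyz:x\in X,y\in Y,z\in Z\text{ pairwise distinct}\}$. A $3$-graph is a pair $H=(V,F)$ with $F\subseteq\binom V3$. A hereditary $3$-graph property is a class of finite $3$-graphs closed under isomorphism and induced sub-$3$-graphs. An equipartition is a partition whose parts differ in size by at most $1$. Given $H=(V,F)$, $\mathrm{Trip}(H)$ is the $3$-partite $3$-graph with vertex set $\{x_v:v\in V\}\cup\{y_v:v\in V\}\cup\{z_v:v\in V\}$ (three disjoint copies of $V$) and edge set $\{x_vy_{v'}z_{v''}:vv'v''\in F\}$. For a $3$-graph $\Gamma$, $\Gamma\in\mathrm{Trip}(\mathcal{H})$ means that for some $H\in\mathcal{H}$, $\Gamma$ is isomorphic to an induced sub-$3$-graph of $\mathrm{Trip}(H)$. $\overline{H}(k)$ is the $3$-graph with vertex set $\{a_i,b_i,c_i:i\in[k]\}$ ($3k$ distinct vertices) and edge set $\{a_ub_vc_w:u,v,w\in[k],v\leq w\}$. A $3$-partite $3$-graph $(U\cup V\cup W,F)$ with $|F|=d|U||V||W|$ has $\mathrm{vdisc}_3(\epsilon)$ if for all $U'\subseteq U$, $V'\subseteq V$, $W'\subseteq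 W$, $\big||F\cap K_3[U',V',W']|-d|U'||V'||W'|\big|\leq\epsilon|U||V||W|$. $\mathcal{H}$ admits zero $\mathrm{vdisc}_3$-error if for all $\epsilon>0$ and $t_0\geq1$ there are $T,N$ such that for every $H=(V,F)\in\mathcal{H}$ with $|V|\geq N$ there is an equipartition $\mathcal{P}$ of $V$ into $t$ parts, $t_0\leq t\leq T$, such that for every three distinct parts $X,Y,Z\in\mathcal{P}$ the $3$-graph $(X\cup Y\cup Z,F\cap K_3[X,Y,Z])$ has $\mathrm{vdisc}_3(\epsilon)$. -}

module Defs where

open import Data.Bool.Base using (Bool; true; false; _∧_; _∨_; T)
open import Data.Bool.Properties using (T-∨; T-∧)
open import Data.Bool.Solver using (module ∨-∧-Solver)
open import Data.Fin.Base using (Fin)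
open import Data.Fin.Properties using (_≟_; _≤?_; _<?_)
open import Data.Fin.Subset using (Subset; _∈_; _⊆_; ∣_∣; Nonempty)
open import Data.Fin.Subset.Properties using (_∈?_)
open import Data.Integer.Base using (+_)
open import Data.List.Base using (length; filterᵇ; allFin; cartesianProduct)
open import Data.Nat.Base as ℕ using (ℕ)
open import Data.Product.Base using (Σ; ∃; _×_; _,_; proj₁; proj₂)
open import Data.Rational.Base as ℚ using (ℚ; 0ℚ)
open import Data.Sum.Base using (inj₁; inj₂)
open import Function.Base using (_∘_)
open import Function.Bundles using (_↔_; Equivalence; Inverse)
open import Level using (Level; suc)
open import Relation.Binary.PropositionalEquality using (_≡_; _≢_; refl; sym; cong₂)
open import Relation.Nullary.Decidable using (Dec; ⌊_⌋; toWitness; _×-dec_; ¬?)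

private
  variable
    ℓ : Level
    V W : Set
    m n t : ℕ

Distinct : V → V → V → Set
Distinct x y z = x ≢ y × y ≢ z × x ≢ z

------------------------------------------------------------------------
-- 3-graphs

-- The edge set F ⊆ (V choose 3) is given by its indicator on ordered
-- triples: edge x y z is true iff {x , y , z} ∈ F. The two symmetries
-- generate all permutations of the triple.

record Graph₃ (V : Set) : Set where
  field
    edge     : V → V → V → Bool
    swap     : ∀ x y z → edge x y z ≡ edge y x z
    rotate   : ∀ x y z → edge x y z ≡ edge y z x
    distinct : ∀ x y z → T (edge x y z) → Distinct x y z

open Graph₃ public

symmetrise : (V → V → V → Bool) → V → V → V → Bool
symmetrise R x y z =
  R x y z ∨ R x z y ∨ R y x z ∨ R y z x ∨ R z x y ∨ R z y x

-- The 3-graph with edge set { {x , y , z} : R x y z }.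

fromTriples : (R : V → V → V → Bool) →
              (∀ x y z → T (R x y z) → Distinct x y z) → Graph₃ V
fromTriples {V} R R-distinct = record
  { edge     = symmetrise R
  ; swap     = λ x y z →
      solve 6 (λ a b c d e f →
        a :+ (b :+ (c :+ (d :+ (e :+ f)))) := c :+ (d :+ (a :+ (b :+ (f :+ e)))))
        refl (R x y z) (R x z y) (R y x z) (R y z x) (R z x y) (R z y x)
  ; rotate   = λ x y z →
      solve 6 (λ a b c d e f →
        a :+ (b :+ (c :+ (d :+ (e :+ f)))) := d :+ (c :+ (f :+ (e :+ (a :+ b)))))
        refl (R x y z) (R x z y) (R y x z) (R y z x) (R z x y) (R z y x)
  ; distinct = sym-distinct
  }
  where
  open ∨-∧-Solver

  split : ∀ {a b} → T (a ∨ b) → _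
  split {a} {b} = Equivalence.to (T-∨ {a} {b})

  sym-distinct : ∀ x y z → T (symmetrise R x y z) → Distinct x y z
  sym-distinct x y z p with split {R x y z} p
  ... | inj₁ q = R-distinct x y z q
  ... | inj₂ p with split {R x z y} p
  ... | inj₁ q = let (a , b , c) = R-distinct x z y q in c , b ∘ sym , a
  ... | inj₂ p with split {R y x z} p
  ... | inj₁ q = let (a , b , c) = R-distinct y x z q in a ∘ sym , c , b
  ... | inj₂ p with split {R y z x} p
  ... | inj₁ q = let (a , b , c) = R-distinct y z x q in c ∘ sym , a , b ∘ sym
  ... | inj₂ p with split {R z x y} p
  ... | inj₁ q = let (a , b , c) = R-distinct z x y q in b , c ∘ sym , a ∘ sym
  ... | inj₂ q = let (a , b , c) = R-distinct z y x q in b ∘ sym , a ∘ sym , c ∘ sym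

infixl 7 _∩_

_∩_ : Graph₃ V → Graph₃ V → Graph₃ V
G ∩ H = record
  { edge     = λ x y z → edge G x y z ∧ edge H x y z
  ; swap     = λ x y z → cong₂ _∧_ (swap G x y z) (swap H x y z)
  ; rotate   = λ x y z → cong₂ _∧_ (rotate G x y z) (rotate H x y z)
  ; distinct = λ x y z p →
      distinct G x y z (proj₁ (Equivalence.to (T-∧ {edge G x y z}) p))
  }

infix 8 _[_]

_[_] : Graph₃ V → (S : V → Bool) → Graph₃ (Σ V (T ∘ S))
G [ S ] = record
  { edge     = λ x y z → edge G (proj₁ x) (proj₁ y) (proj₁ z)
  ; swap     = λ x y z → swap G (proj₁ x) (proj₁ y) (proj₁ z)
  ; rotate   = λ x y z → rotate G (proj₁ x) (proj₁ y) (proj₁ z)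
  ; distinct = λ x y z p →
      let (a , b , c) = distinct G (proj₁ x) (proj₁ y) (proj₁ z) p
      in (λ { refl → a refl }) , (λ { refl → b refl }) , (λ { refl → c refl })
  }

infix 4 _≅_ _isInducedIn_

record _≅_ (G : Graph₃ V) (H : Graph₃ W) : Set where
  field
    bijection : V ↔ W
  open Inverse bijection using (to) public
  field
    preserves : ∀ x y z → edge G x y z ≡ edge H (to x) (to y) (to z)

-- G is isomorphic to an induced sub-3-graph of H.

_isInducedIn_ : Graph₃ V → Graph₃ W → Set
_isInducedIn_ {W = W} G H = ∃ λ (S : W → Bool) → G ≅ H [ S ]

------------------------------------------------------------------------
-- Hereditary properties

-- Finite 3-graphs are taken on the vertex sets Fin n. This loses nothing
-- for classes closed under isomorphism.

FiniteGraph₃ : Set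
FiniteGraph₃ = ∃ λ n → Graph₃ (Fin n)

Property : ∀ ℓ → Set (suc ℓ)
Property ℓ = FiniteGraph₃ → Set ℓ

record Hereditary (𝓗 : Property ℓ) : Set ℓ where
  field
    closed-iso     : {G : Graph₃ (Fin m)} {H : Graph₃ (Fin n)} →
                     G ≅ H → 𝓗 (n , H) → 𝓗 (m , G)
    -- H [ S ] does not live on some Fin m literally, so the closure is
    -- stated for every copy of it that does.
    closed-induced : {G : Graph₃ (Fin m)} {H : Graph₃ (Fin n)} →
                     G isInducedIn H → 𝓗 (n , H) → 𝓗 (m , G)

------------------------------------------------------------------------
-- Trip and H̄

-- Three disjoint copies of V.

data Copies (V : Set) : Set where
  𝐱 𝐲 𝐳 : V → Copies V

-- The 3-partite 3-graph with edge set { {𝐱 u , 𝐲 v , 𝐳 w} : R u v w }.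

tripartite : (V → V → V → Bool) → Graph₃ (Copies V)
tripartite {V} R = fromTriples R′ R′-distinct
  where
  R′ : Copies V → Copies V → Copies V → Bool
  R′ (𝐱 u) (𝐲 v) (𝐳 w) = R u v w
  R′ _     _     _     = false

  R′-distinct : ∀ p q r → T (R′ p q r) → Distinct p q r
  R′-distinct (𝐱 u) (𝐲 v) (𝐳 w) _ = (λ ()) , (λ ()) , (λ ())

Trip : Graph₃ V → Graph₃ (Copies V)
Trip H = tripartite (edge H)

infix 4 _∈Trip_

_∈Trip_ : Graph₃ W → Property ℓ → Set ℓ
Γ ∈Trip 𝓗 = ∃ λ (H : FiniteGraph₃) → 𝓗 H × Γ isInducedIn Trip (proj₂ H)

-- 𝐱 i, 𝐲 i, 𝐳 i are the vertices aᵢ, bᵢ, cᵢ; the index set [k] is Fin k.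

H̄ : (k : ℕ) → Graph₃ (Copies (Fin k))
H̄ k = tripartite (λ u v w → ⌊ v ≤? w ⌋)

------------------------------------------------------------------------
-- vdisc₃

K₃[_,_,_] : (X Y Z : Subset n) → Graph₃ (Fin n)
K₃[ X , Y , Z ] = fromTriples (λ x y z → ⌊ triple? x y z ⌋)
  (λ x y z p → proj₂ (proj₂ (proj₂ (toWitness {a? = triple? x y z} p))))
  where
  triple? : ∀ x y z → Dec (x ∈ X × y ∈ Y × z ∈ Z × Distinct x y z)
  triple? x y z = x ∈? X ×-dec y ∈? Y ×-dec z ∈? Z ×-dec
                  ¬? (x ≟ y) ×-dec ¬? (y ≟ z) ×-dec ¬? (x ≟ z)

-- Every 3-element set {x , y , z} is counted once, as x < y < z.

edgeCount : Graph₃ (Fin n) → ℕ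
edgeCount {n} G =
  length (filterᵇ (λ (x , y , z) → ⌊ x <? y ⌋ ∧ ⌊ y <? z ⌋ ∧ edge G x y z)
    (cartesianProduct (allFin n) (cartesianProduct (allFin n) (allFin n))))

⟦_⟧ : ℕ → ℚ
⟦ k ⟧ = + k ℚ./ 1

-- For pairwise disjoint U, V, W and F with all edges in K₃[ U , V , W ],
-- this is vdisc₃(ε) of the 3-partite 3-graph (U ∪ V ∪ W , F); elements of
-- Fin n outside U ∪ V ∪ W play no role. If U, V or W is empty, then d is
-- not determined, but the condition does not depend on it.

VDisc₃ : (ε : ℚ) (U V W : Subset n) (F : Graph₃ (Fin n)) → Set
VDisc₃ ε U V W F = ∃ λ (d : ℚ) →
  ⟦ edgeCount F ⟧ ≡ d ℚ.* ⟦ ∣ U ∣ ℕ.* ∣ V ∣ ℕ.* ∣ W ∣ ⟧ ×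
  (∀ U′ V′ W′ → U′ ⊆ U → V′ ⊆ V → W′ ⊆ W →
    ℚ.∣ ⟦ edgeCount (F ∩ K₃[ U′ , V′ , W′ ]) ⟧
        ℚ.- d ℚ.* ⟦ ∣ U′ ∣ ℕ.* ∣ V′ ∣ ℕ.* ∣ W′ ∣ ⟧ ∣
      ℚ.≤ ε ℚ.* ⟦ ∣ U ∣ ℕ.* ∣ V ∣ ℕ.* ∣ W ∣ ⟧)

record Equipartition (n t : ℕ) : Set where
  field
    part     : Fin t → Subset n
    nonempty : ∀ i → Nonempty (part i)
    cover    : ∀ v → ∃ λ i → v ∈ part i
    disjoint : ∀ {i j v} → v ∈ part i → v ∈ part j → i ≡ j
    balanced : ∀ i j → ∣ part i ∣ ℕ.≤ ℕ.suc ∣ part j ∣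

open Equipartition public

-- Rational ε suffice, since VDisc₃ ε is monotone in ε.

AdmitsZeroVDisc₃Error : Property ℓ → Set ℓ
AdmitsZeroVDisc₃Error 𝓗 =
  ∀ (ε : ℚ) (t₀ : ℕ) → 0ℚ ℚ.< ε → 1 ℕ.≤ t₀ →
  ∃ λ (T₀ : ℕ) → ∃ λ (N : ℕ) →
  ∀ (n : ℕ) (H : Graph₃ (Fin n)) → 𝓗 (n , H) → N ℕ.≤ n →
  ∃ λ (t : ℕ) → t₀ ℕ.≤ t × t ℕ.≤ T₀ ×
  ∃ λ (𝓟 : Equipartition n t) →
  ∀ i j k → Distinct i j k →
  let X = part 𝓟 i
      Y = part 𝓟 j
      Z = part 𝓟 k
  in VDisc₃ ε X Y Z (H ∩ K₃[ X , Y , Z ])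

{-# OPTIONS --safe #-}

-- A copy of H̄ k in Trip H is a triple of injections f, g, h into H with
-- {f u, g v, h w} an edge iff v ≤ w; restrict H to their ranges. Let an
-- equipartition into t ≥ 24 parts be given and let D be a fixed fraction of
-- the part size. Call an index x central if the part of g x contains g y for
-- at least D indices y < x and at least D indices y > x, and likewise for h x.
-- Each part spoils at most 4 D indices, so many indices are central.
--
-- If g x and h x lie in different parts for some central x, then these two
-- parts contain a complete and an edge-free pattern, each with D vertices on
-- both sides. Otherwise, as parts are small, there are central x < y such that
-- g x and h x lie in one part and g y and h y in another. The points of g below
-- x and of h above y then give the complete pattern, those of h below x and of g
-- above y the edge-free one. A third part with many points of f completes
-- an irregular triple.

module Submission where

open import Defs
import Algebra.Properties.Group
open import Data.Bool.Base using (Bool; _∧_; T)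
open import Data.Bool.Properties using (T-∨; T-∧; T-≡; T-irrelevant; ∨-identityʳ)
open import Data.Fin.Base as Fin using (Fin; zero; suc; fromℕ<; inject≤; combine)
open import Data.Fin.Properties as Fin
  using (all?; any?; suc-injective; injective⇒≤; *↔×; fromℕ<-injective; inject≤-injective; combine-injective)
open import Data.Fin.Subset using (Subset; inside; outside; _∈_; _∉_; _⊆_; ∣_∣; _∪_; ⊤)
open import Data.Fin.Subset.Properties using (_∈?_; ∈⊤; ∣p∣≤n; x∈p∪q⁺; p⊂q⇒∣p∣<∣q∣)
open import Data.Integer.Base as ℤ using (+_)
open import Data.Integer.Properties as ℤ using ()
open import Data.List.Base using (List; []; _∷_; length; filter; allFin; cartesianProduct)
open import Data.List.Membership.Propositional as List using ()
open import Data.List.Membership.Propositional.Properties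
  using (∈-filter⁺; ∈-filter⁻; ∈-cartesianProduct⁺; ∈-allFin)
open import Data.List.Membership.Setoid.Properties using (index-injective)
open import Data.List.Relation.Binary.Permutation.Propositional using (_↭_; ↭-refl; ↭-sym; ↭-trans; ↭-swap)
open import Data.List.Relation.Binary.Permutation.Propositional.Properties using (∈-resp-↭; shift)
open import Data.List.Relation.Unary.Any using (here; there; index)
open import Data.Nat.Base
  using (ℕ; zero; suc; _+_; _*_; _∸_; _/_; _%_; _≤_; _<_; z≤n; s≤s; s≤s⁻¹)
open import Data.Nat.DivMod using (m/n*n≤m; m%n<n; m≡m%n+[m/n]*n; m≥n⇒m/n>0)
open import Data.Nat.Properties as ℕ using ()
open import Data.Nat.Solver using (module +-*-Solver)
open import Data.Product.Base using (Σ; ∃; _×_; _,_; proj₁; proj₂)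
open import Data.Rational.Base as ℚ using (ℚ; 0ℚ; ½; 1ℚ; toℚᵘ; 1/_)
open import Data.Rational.Properties as ℚ using ()
open import Data.Rational.Unnormalised.Base as ℚᵘ using (mkℚᵘ)
open import Data.Rational.Unnormalised.Properties as ℚᵘ using ()
open import Data.Sum.Base using (inj₁; inj₂)
open import Data.Vec.Base using ([]; _∷_; here; there; tabulate; lookup)
open import Data.Vec.Properties using (lookup∘tabulate; []=⇒lookup; lookup⇒[]=)
open import Function.Base using (_∘_; _$_; case_of_)
open import Function.Bundles using (Equivalence; Inverse; Injection; mk↔ₛ′)
open import Function.Properties.Inverse using (Inverse⇒Injection)
open import Level using (Level; 0ℓ)
open import Relation.Binary.Core using (Rel)
import Relation.Binary.Construct.Flip.EqAndOrd as Flip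
open import Relation.Binary.Definitions using (tri<; tri≈; tri>)
open import Relation.Binary.PropositionalEquality
  using (_≡_; _≢_; refl; sym; trans; cong; cong₂; subst; setoid)
open import Relation.Binary.Structures using (IsStrictTotalOrder)
open import Relation.Nullary.Decidable
  using (Dec; does; yes; no; ⌊_⌋; toWitness; fromWitness; from-yes; T?; dec-true; ¬?; _×-dec_; _→-dec_)
open import Relation.Nullary.Negation using (¬_; contradiction)
open import Relation.Unary using (Decidable)

open Algebra.Properties.Group ℚ.+-0-group using (⁻¹-involutive)

private
  variable
    ℓ : Level
    A : Set
    a b c k m n t : ℕ
    P : Fin n → Set ℓ

-- Finite sets

⟪_⟫ : Decidable P → Subset _
⟪ P? ⟫ = tabulate (does ∘ P?)

∈⟪⟫⁺ : (P? : Decidable P) → ∀ {x} → P x → x ∈ ⟪ P? ⟫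
∈⟪⟫⁺ P? {x} px = lookup⇒[]= x _ (trans (lookup∘tabulate (does ∘ P?) x) (dec-true (P? x) px))

∈⟪⟫⁻ : (P? : Decidable P) → ∀ {x} → x ∈ ⟪ P? ⟫ → P x
∈⟪⟫⁻ P? {x} x∈ with P? x | trans (sym (lookup∘tabulate (does ∘ P?) x)) ([]=⇒lookup x∈)
... | yes px | _ = px
... | no  _  | ()

-- With its inverse `position`, this enumeration identifies `p` with `Fin ∣ p ∣`, so that
-- cardinality bounds become injections between `Fin` types.
element : (p : Subset n) → Fin ∣ p ∣ → Fin n
element (inside  ∷ p) zero    = zero
element (inside  ∷ p) (suc i) = suc (element p i)
element (outside ∷ p) i       = suc (element p i)

element∈ : (p : Subset n) (i : Fin ∣ p ∣) → element p i ∈ p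
element∈ (inside  ∷ p) zero    = here
element∈ (inside  ∷ p) (suc i) = there (element∈ p i)
element∈ (outside ∷ p) i       = there (element∈ p i)

position : (p : Subset n) {x : Fin n} → x ∈ p → Fin ∣ p ∣
position (inside  ∷ p) here       = zero
position (inside  ∷ p) (there x∈) = suc (position p x∈)
position (outside ∷ p) (there x∈) = position p x∈

element-position : (p : Subset n) {x : Fin n} (x∈p : x ∈ p) → element p (position p x∈p) ≡ x
element-position (inside  ∷ p) here       = refl
element-position (inside  ∷ p) (there x∈) = cong suc (element-position p x∈)
element-position (outside ∷ p) (there x∈) = cong suc (element-position p x∈)

element-injective : (p : Subset n) {i j : Fin ∣ p ∣} → element p i ≡ element p j → i ≡ j
element-injective (inside  ∷ p) {zero}  {zero}  _  = refl
element-injective (inside  ∷ p) {suc i} {suc j} eq = cong suc (element-injective p (suc-injective eq))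
element-injective (outside ∷ p)                 eq = element-injective p (suc-injective eq)

position-injective : (p : Subset n) {x y : Fin n} (x∈p : x ∈ p) (y∈p : y ∈ p) →
                     position p x∈p ≡ position p y∈p → x ≡ y
position-injective p x∈p y∈p eq =
  trans (sym (element-position p x∈p)) (trans (cong (element p) eq) (element-position p y∈p))

-- The map `φ` receives the membership proof, so its value may rest on facts that hold only on `p`,
-- such as a chosen preimage or a bound on a rank.
injection⇒∣p∣≤ : (p : Subset n) (φ : ∀ {x} → x ∈ p → Fin m) →
                 (∀ {x y} (x∈p : x ∈ p) (y∈p : y ∈ p) → φ x∈p ≡ φ y∈p → x ≡ y) → ∣ p ∣ ≤ m
injection⇒∣p∣≤ p φ φ-injective =
  injective⇒≤ {f = φ ∘ element∈ p} λ {i} {j} eq →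
    element-injective p (φ-injective (element∈ p i) (element∈ p j) eq)

∣p∪q∣≤∣p∣+∣q∣ : (p q : Subset n) → ∣ p ∪ q ∣ ≤ ∣ p ∣ + ∣ q ∣
∣p∪q∣≤∣p∣+∣q∣ []            []            = z≤n
∣p∪q∣≤∣p∣+∣q∣ (outside ∷ p) (outside ∷ q) = ∣p∪q∣≤∣p∣+∣q∣ p q
∣p∪q∣≤∣p∣+∣q∣ (outside ∷ p) (inside  ∷ q) =
  ℕ.≤-trans (s≤s (∣p∪q∣≤∣p∣+∣q∣ p q)) (ℕ.≤-reflexive (sym (ℕ.+-suc ∣ p ∣ ∣ q ∣)))
∣p∪q∣≤∣p∣+∣q∣ (inside  ∷ p) (outside ∷ q) = s≤s (∣p∪q∣≤∣p∣+∣q∣ p q)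
∣p∪q∣≤∣p∣+∣q∣ (inside  ∷ p) (inside  ∷ q) =
  s≤s (ℕ.≤-trans (∣p∪q∣≤∣p∣+∣q∣ p q) (ℕ.+-monoʳ-≤ ∣ p ∣ (ℕ.n≤1+n ∣ q ∣)))

∣p∪q∣≤ : (p q : Subset n) → ∣ p ∣ ≤ a → ∣ q ∣ ≤ b → ∣ p ∪ q ∣ ≤ a + b
∣p∪q∣≤ p q ∣p∣≤a ∣q∣≤b = ℕ.≤-trans (∣p∪q∣≤∣p∣+∣q∣ p q) (ℕ.+-mono-≤ ∣p∣≤a ∣q∣≤b)

∣p∣<n⇒∃∉ : (p : Subset n) → ∣ p ∣ < n → ∃ λ x → x ∉ p
∣p∣<n⇒∃∉ (outside ∷ p) _           = zero , λ ()
∣p∣<n⇒∃∉ (inside  ∷ p) (s≤s ∣p∣<n) with x , x∉p ← ∣p∣<n⇒∃∉ p ∣p∣<n = suc x , λ { (there x∈p) → x∉p x∈p }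

image? : (f : Fin m → Fin n) (p : Subset m) → Decidable (λ y → ∃ λ x → x ∈ p × f x ≡ y)
image? f p y = any? λ x → x ∈? p ×-dec f x Fin.≟ y

image : (Fin m → Fin n) → Subset m → Subset n
image f p = ⟪ image? f p ⟫

∈image⁺ : (f : Fin m → Fin n) (p : Subset m) → ∀ {x} → x ∈ p → f x ∈ image f p
∈image⁺ f p {x} x∈p = ∈⟪⟫⁺ (image? f p) (x , x∈p , refl)

∈image⁻ : (f : Fin m → Fin n) (p : Subset m) → ∀ {y} → y ∈ image f p → ∃ λ x → x ∈ p × f x ≡ y
∈image⁻ f p = ∈⟪⟫⁻ (image? f p)

-- Each point of the image is sent to the preimage stored in its membership proof; `f` maps that
-- preimage back, so distinct points have distinct preimages.
∣image∣≤∣p∣ : (f : Fin m → Fin n) (p : Subset m) → ∣ image f p ∣ ≤ ∣ p ∣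
∣image∣≤∣p∣ f p = injection⇒∣p∣≤ (image f p)
  (λ y∈ → position p (proj₁ (proj₂ (∈image⁻ f p y∈))))
  λ y∈ z∈ eq → let (u , u∈p , fu≡y) = ∈image⁻ f p y∈ ; (v , v∈p , fv≡z) = ∈image⁻ f p z∈
               in trans (sym fu≡y) (trans (cong f (position-injective p u∈p v∈p eq)) fv≡z)

injective⇒∣p∣≤∣q∣ : (f : Fin m → Fin n) → (∀ {x y} → f x ≡ f y → x ≡ y) →
                    (p : Subset m) (q : Subset n) → (∀ {x} → x ∈ p → f x ∈ q) → ∣ p ∣ ≤ ∣ q ∣
injective⇒∣p∣≤∣q∣ f f-injective p q f∈ = injection⇒∣p∣≤ p (λ x∈p → position q (f∈ x∈p))
  λ x∈p y∈p eq → f-injective (position-injective q (f∈ x∈p) (f∈ y∈p) eq)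

∣p∣≤∣image∣ : (f : Fin m → Fin n) → (∀ {x y} → f x ≡ f y → x ≡ y) →
              (p : Subset m) → ∣ p ∣ ≤ ∣ image f p ∣
∣p∣≤∣image∣ f f-injective p = injective⇒∣p∣≤∣q∣ f f-injective p (image f p) (∈image⁺ f p)

injective₂⇒*≤ : (f : Fin a → Fin b → Fin m) →
                (∀ {i i′ j j′} → f i j ≡ f i′ j′ → i ≡ i′ × j ≡ j′) → a * b ≤ m
injective₂⇒*≤ {a} {b} f f-injective =
  injective⇒≤ {f = λ x → f (proj₁ (to x)) (proj₂ (to x))} λ eq →
    Injection.injective (Inverse⇒Injection (*↔× {a} {b})) (cong₂ _,_ (proj₁ (f-injective eq)) (proj₂ (f-injective eq)))
  where open Inverse (*↔× {a} {b}) using (to)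

injective₃⇒*≤ : (f : Fin a → Fin b → Fin c → Fin m) →
                (∀ {i i′ j j′ l l′} → f i j l ≡ f i′ j′ l′ → i ≡ i′ × j ≡ j′ × l ≡ l′) →
                a * b * c ≤ m
injective₃⇒*≤ {a} {b} f f-injective =
  injective₂⇒*≤ (λ x → f (proj₁ (to x)) (proj₂ (to x))) λ eq →
    let (i≡ , j≡ , l≡) = f-injective eq
    in Injection.injective (Inverse⇒Injection (*↔× {a} {b})) (cong₂ _,_ i≡ j≡) , l≡
  where open Inverse (*↔× {a} {b}) using (to)

-- Counting edges

-- A transposition and a rotation generate all six orders of a triple, so a symmetric claim reduces
-- to the increasing order, the one that `edgeCount` counts.
sort-induction : (Q : Fin n → Fin n → Fin n → Set) →
  (∀ {x y z} → Q x y z → Q y x z) → (∀ {x y z} → Q x y z → Q y z x) →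
  (∀ {x y z} → x Fin.< y → y Fin.< z → Q x y z) → ∀ {x y z} → Distinct x y z → Q x y z
sort-induction Q sw ro base {x} {y} {z} (x≢y , y≢z , x≢z)
  with Fin.<-cmp x y | Fin.<-cmp y z | Fin.<-cmp x z
... | tri≈ _ e _ | _          | _          = contradiction e x≢y
... | _          | tri≈ _ e _ | _          = contradiction e y≢z
... | _          | _          | tri≈ _ e _ = contradiction e x≢z
... | tri< p _ _ | tri< q _ _ | _          = base p q
... | tri< _ _ _ | tri> _ _ q | tri< r _ _ = sw (ro (ro (base r q)))
... | tri< p _ _ | tri> _ _ _ | tri> _ _ r = ro (base r p)
... | tri> _ _ p | tri< _ _ _ | tri< r _ _ = sw (base p r)
... | tri> _ _ _ | tri< q _ _ | tri> _ _ r = ro (ro (base q r))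
... | tri> _ _ p | tri> _ _ q | _          = sw (ro (base q p))

isIncreasingEdge : Graph₃ (Fin n) → Fin n × Fin n × Fin n → Bool
isIncreasingEdge G (x , y , z) = ⌊ x Fin.<? y ⌋ ∧ ⌊ y Fin.<? z ⌋ ∧ edge G x y z

T-∧⁺ : ∀ {x y} → T x → T y → T (x ∧ y)
T-∧⁺ p q = Equivalence.from T-∧ (p , q)

T-∧⁻ : ∀ {x y} → T (x ∧ y) → T x × T y
T-∧⁻ = Equivalence.to T-∧

vertices : Fin n × Fin n × Fin n → List (Fin n)
vertices (x , y , z) = x ∷ y ∷ z ∷ []

-- Only the increasing order of an edge is listed by `edgeCount`; the permutation lets the original
-- vertices be recovered from it.
IncreasingOrder : Graph₃ (Fin n) → Fin n → Fin n → Fin n → Set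
IncreasingOrder G x y z = ∃ λ t → T (isIncreasingEdge G t) × vertices (x , y , z) ↭ vertices t

sortEdge : (G : Graph₃ (Fin n)) → ∀ {x y z} → T (edge G x y z) → IncreasingOrder G x y z
sortEdge {n} G {x} {y} {z} e = sort-induction Q sw ro base (distinct G x y z e) e
  where
  Q : Fin n → Fin n → Fin n → Set
  Q x y z = T (edge G x y z) → IncreasingOrder G x y z

  sw : ∀ {x y z} → Q x y z → Q y x z
  sw {x} {y} {z} Qxyz e with t , t-edge , π ← Qxyz (subst T (swap G y x z) e) =
    t , t-edge , ↭-trans (↭-swap y x ↭-refl) π

  ro : ∀ {x y z} → Q x y z → Q y z x
  ro {x} {y} {z} Qxyz e with t , t-edge , π ← Qxyz (subst T (sym (rotate G x y z)) e) =
    t , t-edge , ↭-trans (shift x (y ∷ z ∷ []) []) π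

  base : ∀ {x y z} → x Fin.< y → y Fin.< z → Q x y z
  base {x} {y} {z} x<y y<z e =
    (x , y , z) ,
    T-∧⁺ (fromWitness {a? = x Fin.<? y} x<y) (T-∧⁺ (fromWitness {a? = y Fin.<? z} y<z) e) , ↭-refl

-- Each triple goes to the index of its sorted form in the list of edges. If two triples have the
-- same sorted form, each vertex of one occurs in the other, and it must occur in the same
-- coordinate: a vertex of `U` never equals one of `V` or `W`, because by completeness the mixed
-- triples are edges too and so have distinct vertices.
∣U∣∣V∣∣W∣≤edgeCount : (G : Graph₃ (Fin n)) (U V W : Subset n) →
  (∀ {u v w} → u ∈ U → v ∈ V → w ∈ W → T (edge G u v w)) → ∣ U ∣ * ∣ V ∣ * ∣ W ∣ ≤ edgeCount G
∣U∣∣V∣∣W∣≤edgeCount G U V W complete =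
  injective₃⇒*≤ (λ i j l → index (listed i j l)) λ {i} {i′} {j} {j′} {l} {l′} eq →
    same {i} {i′} {j} {j′} {l} {l′} (index-injective (setoid _) (listed i j l) (listed i′ j′ l′) eq)
  where
  module _ (i : Fin ∣ U ∣) (j : Fin ∣ V ∣) (l : Fin ∣ W ∣) where
    u = element U i
    v = element V j
    w = element W l
    sorted = sortEdge G (complete (element∈ U i) (element∈ V j) (element∈ W l))
    listed = ∈-filter⁺ (T? ∘ isIncreasingEdge G)
      (∈-cartesianProduct⁺ (∈-allFin _) (∈-cartesianProduct⁺ (∈-allFin _) (∈-allFin _)))
      (proj₁ (proj₂ sorted))

  same : ∀ {i i′ j j′ l l′} → proj₁ (sorted i j l) ≡ proj₁ (sorted i′ j′ l′) →
         i ≡ i′ × j ≡ j′ × l ≡ l′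
  same {i} {i′} {j} {j′} {l} {l′} eq =
    first (∈-resp-↭ π (here refl)) , second (∈-resp-↭ π (there (here refl))) ,
    third (∈-resp-↭ π (there (there (here refl))))
    where
    π : u i j l ∷ v i j l ∷ w i j l ∷ [] ↭ u i′ j′ l′ ∷ v i′ j′ l′ ∷ w i′ j′ l′ ∷ []
    π = ↭-trans (proj₂ (proj₂ (sorted i j l)))
          (subst (λ t → vertices t ↭ _) (sym eq) (↭-sym (proj₂ (proj₂ (sorted i′ j′ l′)))))

    apart : ∀ i j l → Distinct (element U i) (element V j) (element W l)
    apart i j l = distinct G _ _ _ (complete (element∈ U i) (element∈ V j) (element∈ W l))

    first : _ → i ≡ i′
    first (here u≡u′)                = element-injective U u≡u′
    first (there (here u≡v′))        = contradiction u≡v′ (proj₁ (apart i j′ l))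
    first (there (there (here u≡w′))) = contradiction u≡w′ (proj₂ (proj₂ (apart i j l′)))

    second : _ → j ≡ j′
    second (here v≡u′)                = contradiction (sym v≡u′) (proj₁ (apart i′ j l))
    second (there (here v≡v′))        = element-injective V v≡v′
    second (there (there (here v≡w′))) = contradiction v≡w′ (proj₁ (proj₂ (apart i j l′)))

    third : _ → l ≡ l′
    third (here w≡u′)                = contradiction (sym w≡u′) (proj₂ (proj₂ (apart i′ j l)))
    third (there (here w≡v′))        = contradiction (sym w≡v′) (proj₁ (proj₂ (apart i j′ l)))
    third (there (there (here w≡w′))) = element-injective W w≡w′

-- Repeats the test local to K₃[_,_,_], so that its edges unfold to ⌊ triple? X Y Z x y z ⌋.
triple? : (X Y Z : Subset n) → ∀ x y z → Dec (x ∈ X × y ∈ Y × z ∈ Z × Distinct x y z)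
triple? X Y Z x y z = x ∈? X ×-dec y ∈? Y ×-dec z ∈? Z ×-dec
                      ¬? (x Fin.≟ y) ×-dec ¬? (y Fin.≟ z) ×-dec ¬? (x Fin.≟ z)

symmetrise⁺ : (R : A → A → A → Bool) → ∀ {x y z} → T (R x y z) → T (symmetrise R x y z)
symmetrise⁺ R r = Equivalence.from T-∨ (inj₁ r)

-- The six disjuncts of `symmetrise` are the six orders, each reached from `R` by the two generating
-- permutations.
symmetrise-induction : (R : A → A → A → Bool) (Q : A → A → A → Set) →
  (∀ {x y z} → Q x y z → Q y x z) → (∀ {x y z} → Q x y z → Q y z x) →
  (∀ {x y z} → T (R x y z) → Q x y z) → ∀ x y z → T (symmetrise R x y z) → Q x y z
symmetrise-induction R Q sw ro base x y z s with Equivalence.to (T-∨ {R x y z}) s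
... | inj₁ r = base r
... | inj₂ s with Equivalence.to (T-∨ {R x z y}) s
... | inj₁ r = sw (ro (ro (base r)))
... | inj₂ s with Equivalence.to (T-∨ {R y x z}) s
... | inj₁ r = sw (base r)
... | inj₂ s with Equivalence.to (T-∨ {R y z x}) s
... | inj₁ r = ro (ro (base r))
... | inj₂ s with Equivalence.to (T-∨ {R z x y}) s
... | inj₁ r = ro (base r)
... | inj₂ r = sw (ro (base r))

K₃-edge : (X Y Z : Subset n) → ∀ {x y z} → x ∈ X → y ∈ Y → z ∈ Z → Distinct x y z →
          T (edge K₃[ X , Y , Z ] x y z)
K₃-edge X Y Z {x} {y} {z} x∈X y∈Y z∈Z d =
  symmetrise⁺ (λ x y z → ⌊ triple? X Y Z x y z ⌋) (fromWitness {a? = triple? X Y Z x y z} (x∈X , y∈Y , z∈Z , d))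

-- The count meets an edge of `K₃[ U , V , W ]` in sorted order, which may differ from the order
-- `U`, `V`, `W` of the hypothesis. Being a non-edge of `F` is symmetric, so it passes to every
-- order.
edgeFree⇒edgeCount≡0 : (F : Graph₃ (Fin n)) (U V W : Subset n) →
  (∀ {u v w} → u ∈ U → v ∈ V → w ∈ W → ¬ T (edge F u v w)) → edgeCount (F ∩ K₃[ U , V , W ]) ≡ 0
edgeFree⇒edgeCount≡0 {n} F U V W free = empty _ λ {t} → none t
  where
  G = F ∩ K₃[ U , V , W ]

  allTriples : List (Fin n × Fin n × Fin n)
  allTriples = cartesianProduct (allFin n) (cartesianProduct (allFin n) (allFin n))

  notEdge : ∀ x y z → T (edge K₃[ U , V , W ] x y z) → ¬ T (edge F x y z)
  notEdge = symmetrise-induction (λ x y z → ⌊ triple? U V W x y z ⌋) (λ x y z → ¬ T (edge F x y z))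
    (λ {x} {y} {z} ¬e → ¬e ∘ subst T (swap F y x z))
    (λ {x} {y} {z} ¬e → ¬e ∘ subst T (sym (rotate F x y z)))
    (λ {x} {y} {z} s → let (u∈ , v∈ , w∈ , _) = toWitness {a? = triple? U V W x y z} s in free u∈ v∈ w∈)

  none : ∀ t → ¬ (t List.∈ filter (T? ∘ isIncreasingEdge G) allTriples)
  none (x , y , z) t∈ =
    let e         = proj₂ (∈-filter⁻ (T? ∘ isIncreasingEdge G) {xs = allTriples} t∈)
        inG       = proj₂ (T-∧⁻ {⌊ y Fin.<? z ⌋} (proj₂ (T-∧⁻ {⌊ x Fin.<? y ⌋} e)))
        inF , inK = T-∧⁻ {edge F x y z} inG
    in notEdge x y z inK inF

  empty : {A : Set} (xs : List A) → (∀ {x} → ¬ (x List.∈ xs)) → length xs ≡ 0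
  empty []       _  = refl
  empty (x ∷ xs) x∉ = contradiction (here refl) x∉

-- The half graph inside H

-- The ranges of g and h need not be disjoint: g v ≡ h w is possible when w < v.
record HalfGraph (k : ℕ) (H : Graph₃ (Fin n)) : Set where
  field
    f g h       : Fin k → Fin n
    f-injective : ∀ {u u′} → f u ≡ f u′ → u ≡ u′
    g-injective : ∀ {v v′} → g v ≡ g v′ → v ≡ v′
    h-injective : ∀ {w w′} → h w ≡ h w′ → w ≡ w′
    edge-≤      : ∀ u v w → edge H (f u) (g v) (h w) ≡ ⌊ v Fin.≤? w ⌋

vertex : Copies A → A
vertex (𝐱 v) = v
vertex (𝐲 v) = v
vertex (𝐳 v) = v

side : Copies A → Fin 3
side (𝐱 _) = zero
side (𝐲 _) = suc zero
side (𝐳 _) = suc (suc zero)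

vertex-side-injective : {p q : Copies A} → vertex p ≡ vertex q → side p ≡ side q → p ≡ q
vertex-side-injective {p = 𝐱 _} {𝐱 _} refl _ = refl
vertex-side-injective {p = 𝐲 _} {𝐲 _} refl _ = refl
vertex-side-injective {p = 𝐳 _} {𝐳 _} refl _ = refl

-- Two of the three sides determine the remaining one; the 81 cases are decided by exhaustion. This
-- is what forces an embedding into `Trip H` to respect sides.
third-side : (a b c d : Fin 3) → Distinct a b c → Distinct a d c → b ≡ d
third-side a b c d (a≢b , b≢c , a≢c) (a≢d , d≢c , _) = toWitness
  {a? = all? λ a → all? λ b → all? λ c → all? λ d →
        ¬? (a Fin.≟ b) →-dec ¬? (b Fin.≟ c) →-dec ¬? (a Fin.≟ c) →-dec
        ¬? (a Fin.≟ d) →-dec ¬? (d Fin.≟ c) →-dec b Fin.≟ d} _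
  a b c d a≢b b≢c a≢c a≢d d≢c

-- The other five orders of the triple compute to `false`.
tripartite-edge : (R : A → A → A → Bool) → ∀ u v w → edge (tripartite R) (𝐱 u) (𝐲 v) (𝐳 w) ≡ R u v w
tripartite-edge R u v w = ∨-identityʳ (R u v w)

sameSide⇒¬edge : (R : A → A → A → Bool) → ∀ p q r → side p ≡ side q → ¬ T (edge (tripartite R) p q r)
sameSide⇒¬edge R (𝐱 _) (𝐱 _) (𝐱 _) _ ()
sameSide⇒¬edge R (𝐱 _) (𝐱 _) (𝐲 _) _ ()
sameSide⇒¬edge R (𝐱 _) (𝐱 _) (𝐳 _) _ ()
sameSide⇒¬edge R (𝐲 _) (𝐲 _) (𝐱 _) _ ()
sameSide⇒¬edge R (𝐲 _) (𝐲 _) (𝐲 _) _ ()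
sameSide⇒¬edge R (𝐲 _) (𝐲 _) (𝐳 _) _ ()
sameSide⇒¬edge R (𝐳 _) (𝐳 _) (𝐱 _) _ ()
sameSide⇒¬edge R (𝐳 _) (𝐳 _) (𝐲 _) _ ()
sameSide⇒¬edge R (𝐳 _) (𝐳 _) (𝐳 _) _ ()

tripartite-sides : (R : A → A → A → Bool) → ∀ p q r → T (edge (tripartite R) p q r) →
                   Distinct (side p) (side q) (side r)
tripartite-sides R p q r e =
  (λ eq → sameSide⇒¬edge R p q r eq e) ,
  (λ eq → sameSide⇒¬edge R q r p eq (subst T (rotate G p q r) e)) ,
  (λ eq → sameSide⇒¬edge R r p q (sym eq) (subst T (sym (rotate G r p q)) e))
  where G = tripartite R

-- The analogue of `sort-induction` in which the order of the sides replaces the order of the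
-- vertices.
sides-induction : (Q : Copies A → Copies A → Copies A → Set) →
  (∀ {p q r} → Q p q r → Q q p r) → (∀ {p q r} → Q p q r → Q q r p) →
  (∀ u v w → Q (𝐱 u) (𝐲 v) (𝐳 w)) → ∀ p q r → Distinct (side p) (side q) (side r) → Q p q r
sides-induction Q sw ro base (𝐱 u) (𝐲 v) (𝐳 w) _ = base u v w
sides-induction Q sw ro base (𝐱 u) (𝐳 w) (𝐲 v) _ = sw (ro (ro (base u v w)))
sides-induction Q sw ro base (𝐲 v) (𝐱 u) (𝐳 w) _ = sw (base u v w)
sides-induction Q sw ro base (𝐲 v) (𝐳 w) (𝐱 u) _ = ro (base u v w)
sides-induction Q sw ro base (𝐳 w) (𝐱 u) (𝐲 v) _ = ro (ro (base u v w))
sides-induction Q sw ro base (𝐳 w) (𝐲 v) (𝐱 u) _ = sw (ro (base u v w))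
sides-induction Q sw ro base (𝐱 _) (𝐱 _) _ (a , _) = contradiction refl a
sides-induction Q sw ro base (𝐲 _) (𝐲 _) _ (a , _) = contradiction refl a
sides-induction Q sw ro base (𝐳 _) (𝐳 _) _ (a , _) = contradiction refl a
sides-induction Q sw ro base _ (𝐱 _) (𝐱 _) (_ , b , _) = contradiction refl b
sides-induction Q sw ro base _ (𝐲 _) (𝐲 _) (_ , b , _) = contradiction refl b
sides-induction Q sw ro base _ (𝐳 _) (𝐳 _) (_ , b , _) = contradiction refl b
sides-induction Q sw ro base (𝐱 _) _ (𝐱 _) (_ , _ , c) = contradiction refl c
sides-induction Q sw ro base (𝐲 _) _ (𝐲 _) (_ , _ , c) = contradiction refl c
sides-induction Q sw ro base (𝐳 _) _ (𝐳 _) (_ , _ , c) = contradiction refl c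

Trip-edge : (H : Graph₃ A) → ∀ p q r → Distinct (side p) (side q) (side r) →
            edge (Trip H) p q r ≡ edge H (vertex p) (vertex q) (vertex r)
Trip-edge H = sides-induction (λ p q r → edge (Trip H) p q r ≡ edge H (vertex p) (vertex q) (vertex r))
  (λ {p} {q} {r} eq → trans (swap (Trip H) q p r) (trans eq (swap H _ _ _)))
  (λ {p} {q} {r} eq → trans (sym (rotate (Trip H) p q r)) (trans eq (rotate H _ _ _)))
  (tripartite-edge (edge H))

-- The embedding may permute the three sides of `Trip H`, but it sends each class of `H̄ k` into a
-- single side: two vertices of one class form transversal triples with a common pair. Hence
-- forgetting the side is injective on each class, and as edges of `H` are symmetric, a permutation
-- of the sides does no harm.
H̄-in-Trip⇒HalfGraph : (H : Graph₃ (Fin n)) → H̄ k isInducedIn Trip H → HalfGraph k H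
H̄-in-Trip⇒HalfGraph {n} {k} H (S , H̄≅) = record
  { f = vertex ∘ φ ∘ 𝐱
  ; g = vertex ∘ φ ∘ 𝐲
  ; h = vertex ∘ φ ∘ 𝐳
  ; f-injective = λ {u} {u′} eq → cong vertex $ φ-injective $ vertex-side-injective eq $
      third-side _ _ _ _ (swapped (sides u u u)) (swapped (sides u′ u u))
  ; g-injective = λ {v} {v′} eq → cong vertex $ φ-injective $ vertex-side-injective eq $
      third-side _ _ _ _ (sides v v v) (sides v v′ v)
  ; h-injective = λ {w} {w′} eq → cong vertex $ φ-injective $ vertex-side-injective eq $
      third-side _ _ _ _ (rotated (sides w w w)) (rotated (sides w w w′))
  ; edge-≤ = λ u v w → trans (sym (Trip-edge H _ _ _ (sides u v w))) (edge-φ u v w)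
  }
  where
  open _≅_ H̄≅

  φ : Copies (Fin k) → Copies (Fin n)
  φ = proj₁ ∘ to

  φ-injective : ∀ {p q} → φ p ≡ φ q → p ≡ q
  φ-injective eq = Injection.injective (Inverse⇒Injection bijection) (irrelevant eq)
    where
    irrelevant : ∀ {x y : Σ (Copies (Fin n)) (T ∘ S)} → proj₁ x ≡ proj₁ y → x ≡ y
    irrelevant {x , s} {.x , s′} refl = cong (x ,_) (T-irrelevant s s′)

  edge-φ : ∀ u v w → edge (Trip H) (φ (𝐱 u)) (φ (𝐲 v)) (φ (𝐳 w)) ≡ ⌊ v Fin.≤? w ⌋
  edge-φ u v w = trans (sym (preserves (𝐱 u) (𝐲 v) (𝐳 w))) (tripartite-edge (λ _ v w → ⌊ v Fin.≤? w ⌋) u v w)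

  swapped : ∀ {a b c : Fin 3} → Distinct a b c → Distinct b a c
  swapped (a , b , c) = a ∘ sym , c , b

  rotated : ∀ {a b c : Fin 3} → Distinct a b c → Distinct a c b
  rotated (a , b , c) = c , b ∘ sym , a

  sides≤ : ∀ u {v w} → v Fin.≤ w → Distinct (side (φ (𝐱 u))) (side (φ (𝐲 v))) (side (φ (𝐳 w)))
  sides≤ u {v} {w} v≤w = tripartite-sides (edge H) _ _ _
    (subst T (sym (edge-φ u v w)) (fromWitness {a? = v Fin.≤? w} v≤w))

  sides : ∀ u v w → Distinct (side (φ (𝐱 u))) (side (φ (𝐲 v))) (side (φ (𝐳 w)))
  sides u v w with Fin.≤-total v w
  ... | inj₁ v≤w = sides≤ u v≤w
  -- Here `u`, `v`, `w` need not index an edge. The edges with indices `u`, `w`, `v` and `u`, `v`,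
  -- `v` share their first and third vertices, so `𝐲 w` and `𝐲 v` land on one side, and the edge
  -- with indices `u`, `w`, `w` separates that side from the other two.
  ... | inj₂ w≤v = subst (λ s → Distinct (side (φ (𝐱 u))) s (side (φ (𝐳 w))))
        (third-side _ _ _ _ (sides≤ u w≤v) (sides≤ u (Fin.≤-refl {x = v}))) (sides≤ u (Fin.≤-refl {x = w}))

-- Properties contain only 3-graphs on some `Fin m`, so the induced sub-3-graph is relabelled along
-- `element p`.
induced : Graph₃ (Fin n) → (p : Subset n) → Graph₃ (Fin ∣ p ∣)
induced H p = record
  { edge     = λ x y z → edge H (element p x) (element p y) (element p z)
  ; swap     = λ _ _ _ → swap H _ _ _
  ; rotate   = λ _ _ _ → rotate H _ _ _
  ; distinct = λ x y z e → let (a , b , c) = distinct H _ _ _ e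
                           in a ∘ cong (element p) , b ∘ cong (element p) , c ∘ cong (element p)
  }

induced-isInducedIn : (H : Graph₃ (Fin n)) (p : Subset n) → induced H p isInducedIn H
induced-isInducedIn H p = lookup p , record
  { bijection = mk↔ₛ′ to from to-from from-to
  ; preserves = λ _ _ _ → refl
  }
  where
  to : Fin ∣ p ∣ → Σ _ (T ∘ lookup p)
  to i = element p i , Equivalence.from T-≡ ([]=⇒lookup (element∈ p i))

  member : ∀ {x} → T (lookup p x) → x ∈ p
  member {x} t = lookup⇒[]= x p (Equivalence.to T-≡ t)

  from : Σ _ (T ∘ lookup p) → Fin ∣ p ∣
  from (x , t) = position p (member t)

  to-from : ∀ x → to (from x) ≡ x
  to-from (x , t) = irrelevant (element-position p (member t))
    where
    irrelevant : ∀ {x y} {s : T (lookup p x)} {t : T (lookup p y)} → x ≡ y → (x , s) ≡ (y , t)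
    irrelevant {x} refl = cong (x ,_) (T-irrelevant _ _)

  from-to : ∀ i → from (to i) ≡ i
  from-to i = element-injective p (element-position p _)

-- Heredity allows all vertices outside the three ranges to be discarded. The bound on `n` then
-- keeps `k` a fixed fraction of the vertex set, so that the parts of a fine equipartition are small
-- compared with `k`.
smallHalfGraph : (𝓗 : Property ℓ) → Hereditary 𝓗 → H̄ k ∈Trip 𝓗 →
  ∃ λ n → ∃ λ (H : Graph₃ (Fin n)) → 𝓗 (n , H) × HalfGraph k H × n ≤ k + (k + k)
smallHalfGraph {k = k} 𝓗 hereditary ((n , H) , H∈𝓗 , inTrip) =
  ∣ p ∣ , induced H p , Hereditary.closed-induced hereditary (induced-isInducedIn H p) H∈𝓗 ,
  record
    { f = position p ∘ f∈
    ; g = position p ∘ g∈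
    ; h = position p ∘ h∈
    ; f-injective = f-injective ∘ position-injective p _ _
    ; g-injective = g-injective ∘ position-injective p _ _
    ; h-injective = h-injective ∘ position-injective p _ _
    ; edge-≤ = λ u v w → trans
        (trans (cong (λ x → edge H x _ _) (element-position p (f∈ u)))
          (cong₂ (edge H (f u)) (element-position p (g∈ v)) (element-position p (h∈ w))))
        (edge-≤ u v w)
    } ,
  ∣p∪q∣≤ (range f) _ (∣range∣≤k f) (∣p∪q∣≤ (range g) (range h) (∣range∣≤k g) (∣range∣≤k h))
  where
  open HalfGraph (H̄-in-Trip⇒HalfGraph H inTrip)

  range : (Fin k → Fin n) → Subset n
  range φ = image φ ⊤

  p : Subset n
  p = range f ∪ (range g ∪ range h)

  f∈ : ∀ u → f u ∈ p
  f∈ u = x∈p∪q⁺ (inj₁ (∈image⁺ f ⊤ ∈⊤))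

  g∈ : ∀ v → g v ∈ p
  g∈ v = x∈p∪q⁺ (inj₂ (x∈p∪q⁺ (inj₁ (∈image⁺ g ⊤ ∈⊤))))

  h∈ : ∀ w → h w ∈ p
  h∈ w = x∈p∪q⁺ (inj₂ (x∈p∪q⁺ (inj₂ (∈image⁺ h ⊤ ∈⊤))))

  ∣range∣≤k : ∀ φ → ∣ range φ ∣ ≤ k
  ∣range∣≤k φ = ℕ.≤-trans (∣image∣≤∣p∣ φ ⊤) (∣p∣≤n ⊤)

-- Discrepancy

toℚᵘ-⟦⟧ : ∀ k → toℚᵘ ⟦ k ⟧ ℚᵘ.≃ mkℚᵘ (+ k) 0
toℚᵘ-⟦⟧ k = ℚ.toℚᵘ-fromℚᵘ (mkℚᵘ (+ k) 0)

⟦⟧-mono-≤ : m ≤ n → ⟦ m ⟧ ℚ.≤ ⟦ n ⟧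
⟦⟧-mono-≤ {m} {n} m≤n = ℚ.toℚᵘ-cancel-≤ (begin
  toℚᵘ ⟦ m ⟧     ≃⟨ toℚᵘ-⟦⟧ m ⟩
  mkℚᵘ (+ m) 0   ≤⟨ ℚᵘ.*≤* (ℤ.*-monoʳ-≤-nonNeg (+ 1) (ℤ.+≤+ m≤n)) ⟩
  mkℚᵘ (+ n) 0   ≃⟨ toℚᵘ-⟦⟧ n ⟨
  toℚᵘ ⟦ n ⟧     ∎)
  where open ℚᵘ.≤-Reasoning

⟦⟧-homo-* : ∀ m n → ⟦ m * n ⟧ ≡ ⟦ m ⟧ ℚ.* ⟦ n ⟧
⟦⟧-homo-* m n = ℚ.toℚᵘ-injective (begin
  toℚᵘ ⟦ m * n ⟧                   ≈⟨ toℚᵘ-⟦⟧ (m * n) ⟩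
  mkℚᵘ (+ (m * n)) 0               ≡⟨ cong (λ i → mkℚᵘ i 0) (ℤ.pos-* m n) ⟩
  mkℚᵘ (+ m) 0 ℚᵘ.* mkℚᵘ (+ n) 0   ≈⟨ ℚᵘ.*-cong (toℚᵘ-⟦⟧ m) (toℚᵘ-⟦⟧ n) ⟨
  toℚᵘ ⟦ m ⟧ ℚᵘ.* toℚᵘ ⟦ n ⟧       ≈⟨ ℚ.toℚᵘ-homo-* ⟦ m ⟧ ⟦ n ⟧ ⟨
  toℚᵘ (⟦ m ⟧ ℚ.* ⟦ n ⟧)           ∎)
  where open ℚᵘ.≃-Reasoning

⟦⟧-nonNegative : ∀ n → ℚ.NonNegative ⟦ n ⟧
⟦⟧-nonNegative n = ℚ.nonNegative (⟦⟧-mono-≤ {0} {n} z≤n)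

⟦⟧-positive : 1 ≤ n → ℚ.Positive ⟦ n ⟧
⟦⟧-positive 1≤n = ℚ.positive (ℚ.<-≤-trans (ℚ.positive⁻¹ 1ℚ) (⟦⟧-mono-≤ 1≤n))

smallerThan½/⟦_⟧ : ∀ L → 1 ≤ L → ∃ λ ε → 0ℚ ℚ.< ε × ε ℚ.* ⟦ L ⟧ ℚ.< ½
smallerThan½/⟦ L ⟧ 1≤L = ε , ε>0 , (begin-strict
  ½ ℚ.* ½ ℚ.* L⁻¹ ℚ.* ⟦ L ⟧    ≡⟨ ℚ.*-assoc (½ ℚ.* ½) L⁻¹ ⟦ L ⟧ ⟩
  ½ ℚ.* ½ ℚ.* (L⁻¹ ℚ.* ⟦ L ⟧)  ≡⟨ cong (½ ℚ.* ½ ℚ.*_) (ℚ.*-inverseˡ ⟦ L ⟧) ⟩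
  ½ ℚ.* ½ ℚ.* 1ℚ               <⟨ from-yes (½ ℚ.* ½ ℚ.* 1ℚ ℚ.<? ½) ⟩
  ½                            ∎)
  where
  open ℚ.≤-Reasoning
  instance
    L-positive : ℚ.Positive ⟦ L ⟧
    L-positive = ⟦⟧-positive 1≤L

    L-nonZero : ℚ.NonZero ⟦ L ⟧
    L-nonZero = ℚ.pos⇒nonZero ⟦ L ⟧

  L⁻¹ = 1/ ⟦ L ⟧
  -- This is 1/(4 L), so that the product with `L` is 1/4.
  ε   = ½ ℚ.* ½ ℚ.* L⁻¹

  ε>0 : 0ℚ ℚ.< ε
  ε>0 = ℚ.positive⁻¹ ε {{ℚ.pos*pos⇒pos (½ ℚ.* ½) L⁻¹ {{ℚ.1/pos⇒pos ⟦ L ⟧}}}}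

p≤∣p∣ : ∀ p → p ℚ.≤ ℚ.∣ p ∣
p≤∣p∣ p with ℚ.≤-total 0ℚ p
... | inj₁ 0≤p = ℚ.≤-reflexive (sym (ℚ.0≤p⇒∣p∣≡p 0≤p))
... | inj₂ p≤0 = ℚ.≤-trans p≤0 (ℚ.0≤∣p∣ p)

-p≤∣p∣ : ∀ p → ℚ.- p ℚ.≤ ℚ.∣ p ∣
-p≤∣p∣ p = subst (ℚ.- p ℚ.≤_) (ℚ.∣-p∣≡∣p∣ p) (p≤∣p∣ (ℚ.- p))

½⟦⟧≤ : ∀ {x c a} → ½ ℚ.≤ x → c ≤ a → ½ ℚ.* ⟦ c ⟧ ℚ.≤ x ℚ.* ⟦ a ⟧
½⟦⟧≤ {x} {c} {a} ½≤x c≤a = ℚ.≤-trans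
  (ℚ.*-monoˡ-≤-nonNeg ½ (⟦⟧-mono-≤ c≤a)) (ℚ.*-monoʳ-≤-nonNeg ⟦ a ⟧ {{⟦⟧-nonNegative a}} ½≤x)

-- Whatever d is, one of d and 1 − d is at least ½, and that side is far from regular.
discrepancy : ∀ d E {c a b e} → c ≤ a → c ≤ b → a ≤ e →
  ℚ.∣ ⟦ e ⟧ ℚ.- d ℚ.* ⟦ a ⟧ ∣ ℚ.≤ E → ℚ.∣ ⟦ 0 ⟧ ℚ.- d ℚ.* ⟦ b ⟧ ∣ ℚ.≤ E → ½ ℚ.* ⟦ c ⟧ ℚ.≤ E
discrepancy d E {c} {a} {b} {e} c≤a c≤b a≤e complete empty with ℚ.≤-total ½ d
... | inj₁ ½≤d = begin
  ½ ℚ.* ⟦ c ⟧                        ≤⟨ ½⟦⟧≤ {d} {c} {b} ½≤d c≤b ⟩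
  d ℚ.* ⟦ b ⟧                        ≡⟨ ⁻¹-involutive (d ℚ.* ⟦ b ⟧) ⟨
  ℚ.- (ℚ.- (d ℚ.* ⟦ b ⟧))            ≡⟨ cong ℚ.-_ (ℚ.+-identityˡ _) ⟨
  ℚ.- (⟦ 0 ⟧ ℚ.- d ℚ.* ⟦ b ⟧)        ≤⟨ -p≤∣p∣ _ ⟩
  ℚ.∣ ⟦ 0 ⟧ ℚ.- d ℚ.* ⟦ b ⟧ ∣        ≤⟨ empty ⟩
  E                                  ∎
  where open ℚ.≤-Reasoning
... | inj₂ d≤½ = begin
  ½ ℚ.* ⟦ c ⟧                        ≤⟨ ½⟦⟧≤ {1ℚ ℚ.- d} {c} {a} (ℚ.+-monoʳ-≤ 1ℚ (ℚ.neg-antimono-≤ d≤½)) c≤a ⟩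
  (1ℚ ℚ.- d) ℚ.* ⟦ a ⟧               ≡⟨ ℚ.*-distribʳ-+ ⟦ a ⟧ 1ℚ (ℚ.- d) ⟩
  1ℚ ℚ.* ⟦ a ⟧ ℚ.+ ℚ.- d ℚ.* ⟦ a ⟧   ≡⟨ cong₂ ℚ._+_ (ℚ.*-identityˡ ⟦ a ⟧) (sym (ℚ.neg-distribˡ-* d ⟦ a ⟧)) ⟩
  ⟦ a ⟧ ℚ.- d ℚ.* ⟦ a ⟧              ≤⟨ ℚ.+-monoˡ-≤ (ℚ.- (d ℚ.* ⟦ a ⟧)) (⟦⟧-mono-≤ a≤e) ⟩
  ⟦ e ⟧ ℚ.- d ℚ.* ⟦ a ⟧              ≤⟨ p≤∣p∣ _ ⟩
  ℚ.∣ ⟦ e ⟧ ℚ.- d ℚ.* ⟦ a ⟧ ∣        ≤⟨ complete ⟩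
  E                                  ∎
  where open ℚ.≤-Reasoning

-- Here `c` is a lower bound for the volumes of a complete and an edge-free box, and `L` compares it
-- with the volume of the whole triple. By `discrepancy`, regularity would give c/2 ≤ ε |X||Y||Z| ≤
-- ε L c < c/2.
complete∧empty⇒¬VDisc₃ : ∀ {ε L c} {X Y Z U V W U′ V′ W′ : Subset n} (F : Graph₃ (Fin n)) →
  0ℚ ℚ.< ε → ε ℚ.* ⟦ L ⟧ ℚ.< ½ → 1 ≤ c → ∣ X ∣ * ∣ Y ∣ * ∣ Z ∣ ≤ L * c →
  U  ⊆ X → V  ⊆ Y → W  ⊆ Z → c ≤ ∣ U  ∣ * ∣ V  ∣ * ∣ W  ∣ →
  (∀ {u v w} → u ∈ U → v ∈ V → w ∈ W → T (edge F u v w)) →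
  U′ ⊆ X → V′ ⊆ Y → W′ ⊆ Z → c ≤ ∣ U′ ∣ * ∣ V′ ∣ * ∣ W′ ∣ →
  (∀ {u v w} → u ∈ U′ → v ∈ V′ → w ∈ W′ → ¬ T (edge F u v w)) →
  ¬ VDisc₃ ε X Y Z F
complete∧empty⇒¬VDisc₃ {ε = ε} {L} {c} {X} {Y} {Z} {U} {V} {W} {U′} {V′} {W′} F
  ε>0 εL<½ 1≤c XYZ≤Lc U⊆X V⊆Y W⊆Z c≤UVW complete U′⊆X V′⊆Y W′⊆Z c≤U′V′W′ empty (d , _ , regular) =
  ℚ.<-irrefl refl (begin-strict
    ½ ℚ.* ⟦ c ⟧                          ≤⟨ discrepancy d _ c≤UVW c≤U′V′W′ UVW≤e (regular U V W U⊆X V⊆Y W⊆Z)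
                                             (subst (λ e → ℚ.∣ ⟦ e ⟧ ℚ.- _ ∣ ℚ.≤ _) (edgeFree⇒edgeCount≡0 F U′ V′ W′ empty)
                                               (regular U′ V′ W′ U′⊆X V′⊆Y W′⊆Z)) ⟩
    ε ℚ.* ⟦ ∣ X ∣ * ∣ Y ∣ * ∣ Z ∣ ⟧      ≤⟨ ℚ.*-monoˡ-≤-nonNeg ε {{ℚ.nonNegative (ℚ.<⇒≤ ε>0)}} (⟦⟧-mono-≤ XYZ≤Lc) ⟩
    ε ℚ.* ⟦ L * c ⟧                      ≡⟨ cong (ε ℚ.*_) (⟦⟧-homo-* L c) ⟩
    ε ℚ.* (⟦ L ⟧ ℚ.* ⟦ c ⟧)              ≡⟨ ℚ.*-assoc ε ⟦ L ⟧ ⟦ c ⟧ ⟨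
    ε ℚ.* ⟦ L ⟧ ℚ.* ⟦ c ⟧                <⟨ ℚ.*-monoˡ-<-pos ⟦ c ⟧ {{⟦⟧-positive 1≤c}} εL<½ ⟩
    ½ ℚ.* ⟦ c ⟧                          ∎)
  where
  open ℚ.≤-Reasoning

  UVW≤e : ∣ U ∣ * ∣ V ∣ * ∣ W ∣ ≤ edgeCount (F ∩ K₃[ U , V , W ])
  UVW≤e = ∣U∣∣V∣∣W∣≤edgeCount (F ∩ K₃[ U , V , W ]) U V W λ u∈ v∈ w∈ →
    let e = complete u∈ v∈ w∈
    in T-∧⁺ e (K₃-edge U V W u∈ v∈ w∈ (distinct F _ _ _ e))

-- Central indices and irregular triples

fiber : (Fin k → Fin t) → Fin t → Subset k
fiber σ i = ⟪ (λ x → σ x Fin.≟ i) ⟫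

-- The order is a parameter because the same count is needed for `<` and for its reverse; `before x`
-- then collects the smaller or the larger indices that `σ` sends to the part of `x`.
module Rank {k} {t} {_≺_ : Rel (Fin k) 0ℓ} (≺-isStrictTotalOrder : IsStrictTotalOrder _≡_ _≺_)
            (σ : Fin k → Fin t) where

  open IsStrictTotalOrder ≺-isStrictTotalOrder using (compare; irrefl)
    renaming (trans to ≺-trans; _<?_ to _≺?_)

  before : Fin k → Subset k
  before x = ⟪ (λ y → y ≺? x ×-dec σ y Fin.≟ σ x) ⟫

  ∈before⁻ : ∀ {x y} → y ∈ before x → y ≺ x × σ y ≡ σ x
  ∈before⁻ {x} = ∈⟪⟫⁻ (λ y → y ≺? x ×-dec σ y Fin.≟ σ x)

  ∈before⁺ : ∀ {x y} → y ≺ x → σ y ≡ σ x → y ∈ before x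
  ∈before⁺ {x} y≺x σy≡σx = ∈⟪⟫⁺ (λ y → y ≺? x ×-dec σ y Fin.≟ σ x) (y≺x , σy≡σx)

  -- Within one part `before x` is contained in `before y`, and `x` itself makes the inclusion
  -- proper.
  rank-mono-< : ∀ {x y} → x ≺ y → σ x ≡ σ y → ∣ before x ∣ < ∣ before y ∣
  rank-mono-< {x} x≺y σx≡σy = p⊂q⇒∣p∣<∣q∣
    ( (λ z∈ → let (z≺x , σz≡σx) = ∈before⁻ z∈ in ∈before⁺ (≺-trans z≺x x≺y) (trans σz≡σx σx≡σy))
    , x , ∈before⁺ x≺y σx≡σy , irrefl refl ∘ proj₁ ∘ ∈before⁻)

  rank-injective : ∀ {x y} → σ x ≡ σ y → ∣ before x ∣ ≡ ∣ before y ∣ → x ≡ y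
  rank-injective {x} {y} σx≡σy ranks≡ with compare x y
  ... | tri< x≺y _ _ = contradiction ranks≡ (ℕ.<⇒≢ (rank-mono-< x≺y σx≡σy))
  ... | tri≈ _ x≡y _ = x≡y
  ... | tri> _ _ y≺x = contradiction (sym ranks≡) (ℕ.<⇒≢ (rank-mono-< y≺x (sym σx≡σy)))

  lowRank : ℕ → Subset k
  lowRank D = ⟪ (λ x → ∣ before x ∣ ℕ.<? D) ⟫

  ∉lowRank⁻ : ∀ {D x} → x ∉ lowRank D → D ≤ ∣ before x ∣
  ∉lowRank⁻ {D} x∉ = ℕ.≮⇒≥ (x∉ ∘ ∈⟪⟫⁺ (λ x → ∣ before x ∣ ℕ.<? D))

  -- Ranks are distinct within a part, so a part and a rank below `D` determine the index.
  ∣lowRank∣≤ : ∀ D → ∣ lowRank D ∣ ≤ t * D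
  ∣lowRank∣≤ D = injection⇒∣p∣≤ (lowRank D) (λ {x} x∈ → combine (σ x) (fromℕ< (rank<D x∈)))
    λ x∈ y∈ eq → let (σ≡ , ranks≡) = combine-injective _ _ _ _ eq
                 in rank-injective σ≡ (fromℕ<-injective _ _ (rank<D x∈) (rank<D y∈) ranks≡)
    where
    rank<D : ∀ {x} → x ∈ lowRank D → ∣ before x ∣ < D
    rank<D = ∈⟪⟫⁻ (λ x → ∣ before x ∣ ℕ.<? D)

module Below {k} {t} (σ : Fin k → Fin t) = Rank Fin.<-isStrictTotalOrder σ
module Above {k} {t} (σ : Fin k → Fin t) = Rank (Flip.isStrictTotalOrder Fin.<-isStrictTotalOrder) σ

module _ {n} {t} (𝓟 : Equipartition n t) where

  partOf : Fin n → Fin t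
  partOf v = proj₁ (cover 𝓟 v)

  ∈partOf : ∀ v → v ∈ part 𝓟 (partOf v)
  ∈partOf v = proj₂ (cover 𝓟 v)

  ∣fiber∣≤∣part∣ : (φ : Fin k → Fin n) → (∀ {x y} → φ x ≡ φ y → x ≡ y) →
                   ∀ i → ∣ fiber (partOf ∘ φ) i ∣ ≤ ∣ part 𝓟 i ∣
  ∣fiber∣≤∣part∣ φ φ-injective i = injective⇒∣p∣≤∣q∣ φ φ-injective _ _ λ {x} x∈ →
    subst (λ j → φ x ∈ part 𝓟 j) (∈⟪⟫⁻ (λ x → partOf (φ x) Fin.≟ i) x∈) (∈partOf (φ x))

  parts≥m⇒t*m≤n : (∀ i → m ≤ ∣ part 𝓟 i ∣) → t * m ≤ n
  parts≥m⇒t*m≤n m≤∣part∣ = injective₂⇒*≤ (λ i j → element (part 𝓟 i) (inject≤ j (m≤∣part∣ i)))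
    λ {i} {i′} eq → same (disjoint 𝓟 (element∈ (part 𝓟 i) _) (subst (_∈ part 𝓟 i′) (sym eq) (element∈ (part 𝓟 i′) _))) eq
    where
    same : ∀ {i i′ j j′} → i ≡ i′ →
           element (part 𝓟 i) (inject≤ j (m≤∣part∣ i)) ≡ element (part 𝓟 i′) (inject≤ j′ (m≤∣part∣ i′)) →
           i ≡ i′ × j ≡ j′
    same {i} {j = j} {j′} refl eq =
      refl , inject≤-injective (m≤∣part∣ i) (m≤∣part∣ i) j j′ (element-injective (part 𝓟 i) eq)

  parts≤m⇒n≤t*m : (∀ i → ∣ part 𝓟 i ∣ ≤ m) → n ≤ t * m
  parts≤m⇒n≤t*m {m} ∣part∣≤m = injective⇒≤ {f = λ v → label (∈partOf v)} λ {v} {w} → label-injective (∈partOf v) (∈partOf w)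
    where
    label : ∀ {i v} → v ∈ part 𝓟 i → Fin (t * m)
    label {i} v∈ = combine i (inject≤ (position (part 𝓟 i) v∈) (∣part∣≤m i))

    label-injective : ∀ {i j v w} (v∈ : v ∈ part 𝓟 i) (w∈ : w ∈ part 𝓟 j) → label v∈ ≡ label w∈ → v ≡ w
    label-injective {i} {j} v∈ w∈ eq with combine-injective i _ j _ eq
    ... | refl , eq′ = position-injective (part 𝓟 i) v∈ w∈
          (inject≤-injective (∣part∣≤m i) (∣part∣≤m i) _ _ eq′)

-- Both patterns hold against every point of the range of `f`, so the third part can be chosen
-- afterwards, independently of how the conflict arose.
record Conflict (𝓟 : Equipartition n t) (H : Graph₃ (Fin n)) (f : Fin k → Fin n) (D : ℕ) : Set where
  field
    i j         : Fin t
    i≢j         : i ≢ j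
    V W V′ W′   : Subset n
    V⊆i         : V ⊆ part 𝓟 i
    W⊆j         : W ⊆ part 𝓟 j
    V′⊆i        : V′ ⊆ part 𝓟 i
    W′⊆j        : W′ ⊆ part 𝓟 j
    D≤V         : D ≤ ∣ V ∣
    D≤W         : D ≤ ∣ W ∣
    D≤V′        : D ≤ ∣ V′ ∣
    D≤W′        : D ≤ ∣ W′ ∣
    complete    : ∀ {u v w} → v ∈ V → w ∈ W → T (edge H (f u) v w)
    empty       : ∀ {u v w} → v ∈ V′ → w ∈ W′ → ¬ T (edge H (f u) v w)

module _ {n} {k} {t} {H : Graph₃ (Fin n)} (halfGraph : HalfGraph k H) (𝓟 : Equipartition n t) (D : ℕ) where

  open HalfGraph halfGraph

  private
    β = partOf 𝓟 ∘ g
    γ = partOf 𝓟 ∘ h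

  image⊆part : (φ : Fin k → Fin n) {p : Subset k} {i : Fin t} → (∀ {x} → x ∈ p → partOf 𝓟 (φ x) ≡ i) →
               image φ p ⊆ part 𝓟 i
  image⊆part φ {p} p⊆i y∈ with x , x∈p , refl ← ∈image⁻ φ p y∈ =
    subst (λ i → φ x ∈ part 𝓟 i) (p⊆i x∈p) (∈partOf 𝓟 (φ x))

  ≤-edge : ∀ {u v w} → v Fin.≤ w → T (edge H (f u) (g v) (h w))
  ≤-edge {u} {v} {w} v≤w = subst T (sym (edge-≤ u v w)) (fromWitness {a? = v Fin.≤? w} v≤w)

  >-¬edge : ∀ {u v w} → w Fin.< v → ¬ T (edge H (f u) (g v) (h w))
  >-¬edge {u} {v} {w} w<v e = ℕ.<⇒≱ w<v (toWitness {a? = v Fin.≤? w} (subst T (edge-≤ u v w) e))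

  record Central (x : Fin k) : Set where
    field
      β-below : D ≤ ∣ Below.before β x ∣
      β-above : D ≤ ∣ Above.before β x ∣
      γ-below : D ≤ ∣ Below.before γ x ∣
      γ-above : D ≤ ∣ Above.before γ x ∣

  D≤image : {φ : Fin k → Fin n} → (∀ {x y} → φ x ≡ φ y → x ≡ y) → {p : Subset k} → D ≤ ∣ p ∣ → D ≤ ∣ image φ p ∣
  D≤image {φ} φ-injective {p} D≤p = ℕ.≤-trans D≤p (∣p∣≤∣image∣ φ φ-injective p)

  -- All comparisons pass through `x`: an index below it precedes every index above it, which makes
  -- `g` below with `h` above complete and `g` above with `h` below edge-free. Both patterns lie
  -- between the same two parts.
  β≢γ⇒conflict : ∀ {x} → Central x → β x ≢ γ x → Conflict 𝓟 H f D
  β≢γ⇒conflict {x} central βx≢γx = record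
    { i≢j = βx≢γx
    ; V   = image g (Below.before β x) ; W  = image h (Above.before γ x)
    ; V′  = image g (Above.before β x) ; W′ = image h (Below.before γ x)
    ; V⊆i = image⊆part g (proj₂ ∘ Below.∈before⁻ β) ; W⊆j = image⊆part h (proj₂ ∘ Above.∈before⁻ γ)
    ; V′⊆i = image⊆part g (proj₂ ∘ Above.∈before⁻ β) ; W′⊆j = image⊆part h (proj₂ ∘ Below.∈before⁻ γ)
    ; D≤V = D≤image g-injective β-below ; D≤W = D≤image h-injective γ-above
    ; D≤V′ = D≤image g-injective β-above ; D≤W′ = D≤image h-injective γ-below
    ; complete = complete
    ; empty = empty
    }
    where
    open Central central

    complete : ∀ {u v w} → v ∈ image g (Below.before β x) → w ∈ image h (Above.before γ x) → T (edge H (f u) v w)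
    complete v∈ w∈
      with y , y∈ , refl ← ∈image⁻ g _ v∈ | z , z∈ , refl ← ∈image⁻ h _ w∈ =
      ≤-edge (ℕ.<⇒≤ (ℕ.<-trans (proj₁ (Below.∈before⁻ β y∈)) (proj₁ (Above.∈before⁻ γ z∈))))

    empty : ∀ {u v w} → v ∈ image g (Above.before β x) → w ∈ image h (Below.before γ x) → ¬ T (edge H (f u) v w)
    empty v∈ w∈
      with y , y∈ , refl ← ∈image⁻ g _ v∈ | z , z∈ , refl ← ∈image⁻ h _ w∈ =
      >-¬edge (ℕ.<-trans (proj₁ (Below.∈before⁻ γ z∈)) (proj₁ (Above.∈before⁻ β y∈)))

  -- The parts of `x` and `y` each contain points of both `g` and `h`. The complete pattern takes
  -- `g` from the first part and `h` from the second, the edge-free one takes them the other way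
  -- round, so in both the smaller indices lie in the first part.
  β≡γ⇒conflict : ∀ {x y} → x Fin.< y → Central x → Central y → β x ≡ γ x → β y ≡ γ y → β x ≢ β y →
                 Conflict 𝓟 H f D
  β≡γ⇒conflict {x} {y} x<y x-central y-central βx≡γx βy≡γy βx≢βy = record
    { i≢j = βx≢βy
    ; V   = image g (Below.before β x) ; W  = image h (Above.before γ y)
    ; V′  = image h (Below.before γ x) ; W′ = image g (Above.before β y)
    ; V⊆i = image⊆part g (proj₂ ∘ Below.∈before⁻ β)
    ; W⊆j = image⊆part h (λ z∈ → trans (proj₂ (Above.∈before⁻ γ z∈)) (sym βy≡γy))
    ; V′⊆i = image⊆part h (λ z∈ → trans (proj₂ (Below.∈before⁻ γ z∈)) (sym βx≡γx))
    ; W′⊆j = image⊆part g (proj₂ ∘ Above.∈before⁻ β)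
    ; D≤V = D≤image g-injective X.β-below ; D≤W = D≤image h-injective Y.γ-above
    ; D≤V′ = D≤image h-injective X.γ-below ; D≤W′ = D≤image g-injective Y.β-above
    ; complete = complete
    ; empty = empty
    }
    where
    module X = Central x-central
    module Y = Central y-central

    complete : ∀ {u v w} → v ∈ image g (Below.before β x) → w ∈ image h (Above.before γ y) → T (edge H (f u) v w)
    complete v∈ w∈
      with a , a∈ , refl ← ∈image⁻ g _ v∈ | b , b∈ , refl ← ∈image⁻ h _ w∈ =
      ≤-edge (ℕ.<⇒≤ (ℕ.<-trans (proj₁ (Below.∈before⁻ β a∈)) (ℕ.<-trans x<y (proj₁ (Above.∈before⁻ γ b∈)))))

    empty : ∀ {u v w} → v ∈ image h (Below.before γ x) → w ∈ image g (Above.before β y) → ¬ T (edge H (f u) v w)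
    empty {u} v∈ w∈ e
      with b , b∈ , refl ← ∈image⁻ h _ v∈ | a , a∈ , refl ← ∈image⁻ g _ w∈ =
      >-¬edge (ℕ.<-trans (proj₁ (Below.∈before⁻ γ b∈)) (ℕ.<-trans x<y (proj₁ (Above.∈before⁻ β a∈))))
        -- Exchanging the last two vertices is a rotation, a swap and a rotation back.
        (subst T (trans (rotate H (f u) (h b) (g a)) (trans (swap H (h b) (g a) (f u)) (sym (rotate H (f u) (g a) (h b))))) e)

  central⇒conflict : ∀ {x y} → Central x → Central y → β x ≢ β y → Conflict 𝓟 H f D
  central⇒conflict {x} {y} x-central y-central βx≢βy with β x Fin.≟ γ x | β y Fin.≟ γ y | Fin.<-cmp x y
  ... | no  βx≢γx | _         | _              = β≢γ⇒conflict x-central βx≢γx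
  ... | yes _     | no  βy≢γy | _              = β≢γ⇒conflict y-central βy≢γy
  ... | yes βx≡γx | yes βy≡γy | tri< x<y _ _   = β≡γ⇒conflict x<y x-central y-central βx≡γx βy≡γy βx≢βy
  ... | yes _     | yes _     | tri≈ _ refl _  = contradiction refl βx≢βy
  ... | yes βx≡γx | yes βy≡γy | tri> _ _ y<x   = β≡γ⇒conflict y<x y-central x-central βy≡γy βx≡γx (βx≢βy ∘ sym)

  -- Four low-rank sets of at most `t * D` indices contain all non-central ones. The further `S`
  -- pays for the indices that `g` sends to the part of a first central index, which leaves a second
  -- central index in another part.
  ∃conflict : ∀ {S} → (∀ i → ∣ part 𝓟 i ∣ ≤ S) → 4 * (t * D) + S < k → Conflict 𝓟 H f D
  ∃conflict {S} ∣part∣≤S 4tD+S<k =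
    let x , x-central = ∃central
        y , y-central , βy≢βx = ∃central-outside (β x)
    in central⇒conflict x-central y-central (βy≢βx ∘ sym)
    where
    β↓ = Below.lowRank β D
    β↑ = Above.lowRank β D
    γ↓ = Below.lowRank γ D
    γ↑ = Above.lowRank γ D

    peripheral : Subset k
    peripheral = (β↓ ∪ β↑) ∪ (γ↓ ∪ γ↑)

    ∣peripheral∣≤ : ∣ peripheral ∣ ≤ 4 * (t * D)
    ∣peripheral∣≤ = ℕ.≤-trans
      (∣p∪q∣≤ (β↓ ∪ β↑) (γ↓ ∪ γ↑) (∣p∪q∣≤ β↓ β↑ (Below.∣lowRank∣≤ β D) (Above.∣lowRank∣≤ β D))
                                  (∣p∪q∣≤ γ↓ γ↑ (Below.∣lowRank∣≤ γ D) (Above.∣lowRank∣≤ γ D)))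
      (ℕ.≤-reflexive (solve 1 (λ x → (x :+ x) :+ (x :+ x) := con 4 :* x) refl (t * D)))
      where open +-*-Solver

    central : ∀ {x} → x ∉ peripheral → Central x
    central x∉ = record
      { β-below = Below.∉lowRank⁻ β (x∉ ∘ x∈p∪q⁺ ∘ inj₁ ∘ x∈p∪q⁺ ∘ inj₁)
      ; β-above = Above.∉lowRank⁻ β (x∉ ∘ x∈p∪q⁺ ∘ inj₁ ∘ x∈p∪q⁺ ∘ inj₂)
      ; γ-below = Below.∉lowRank⁻ γ (x∉ ∘ x∈p∪q⁺ ∘ inj₂ ∘ x∈p∪q⁺ ∘ inj₁)
      ; γ-above = Above.∉lowRank⁻ γ (x∉ ∘ x∈p∪q⁺ ∘ inj₂ ∘ x∈p∪q⁺ ∘ inj₂)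
      }

    ∃central : ∃ Central
    ∃central =
      let x , x∉ = ∣p∣<n⇒∃∉ peripheral (ℕ.≤-<-trans ∣peripheral∣≤ (ℕ.≤-<-trans (ℕ.m≤m+n _ S) 4tD+S<k))
      in x , central x∉

    ∃central-outside : ∀ i → ∃ λ x → Central x × β x ≢ i
    ∃central-outside i =
      let x , x∉ = ∣p∣<n⇒∃∉ (peripheral ∪ fiber β i) (ℕ.≤-<-trans
                     (∣p∪q∣≤ peripheral (fiber β i) ∣peripheral∣≤ (ℕ.≤-trans (∣fiber∣≤∣part∣ 𝓟 g g-injective i) (∣part∣≤S i))) 4tD+S<k)
      in x , central (x∉ ∘ x∈p∪q⁺ ∘ inj₁) , x∉ ∘ x∈p∪q⁺ ∘ inj₂ ∘ ∈⟪⟫⁺ (λ x → β x Fin.≟ i)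

  -- Excluding the low-rank indices and the at most `S + S` indices that `f` sends to parts `i` and
  -- `j` leaves an index `u`; the points of `f` before `u` in its part form the required set.
  largeImagePart : ∀ {S} → (∀ i → ∣ part 𝓟 i ∣ ≤ S) → t * D + (S + S) < k → ∀ i j →
    ∃ λ l → l ≢ i × l ≢ j × ∃ λ U → U ⊆ part 𝓟 l × D ≤ ∣ U ∣ × (∀ {v} → v ∈ U → ∃ λ u → f u ≡ v)
  largeImagePart {S} ∣part∣≤S tD+2S<k i j =
    let α = partOf 𝓟 ∘ f
        ∣fiber∣≤S i = ℕ.≤-trans (∣fiber∣≤∣part∣ 𝓟 f f-injective i) (∣part∣≤S i)
        u , u∉ = ∣p∣<n⇒∃∉ (Below.lowRank α D ∪ (fiber α i ∪ fiber α j)) (ℕ.≤-<-trans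
          (∣p∪q∣≤ (Below.lowRank α D) _ (Below.∣lowRank∣≤ α D)
            (∣p∪q∣≤ (fiber α i) (fiber α j) (∣fiber∣≤S i) (∣fiber∣≤S j))) tD+2S<k)
    in α u
     , u∉ ∘ x∈p∪q⁺ ∘ inj₂ ∘ x∈p∪q⁺ ∘ inj₁ ∘ ∈⟪⟫⁺ (λ x → α x Fin.≟ i)
     , u∉ ∘ x∈p∪q⁺ ∘ inj₂ ∘ x∈p∪q⁺ ∘ inj₂ ∘ ∈⟪⟫⁺ (λ x → α x Fin.≟ j)
     , image f (Below.before α u)
     , image⊆part f (proj₂ ∘ Below.∈before⁻ α)
     , D≤image f-injective (Below.∉lowRank⁻ α (u∉ ∘ x∈p∪q⁺ ∘ inj₁))
     , λ v∈ → let (u , _ , fu≡v) = ∈image⁻ f _ v∈ in u , fu≡v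

  -- The same `U` completes both patterns to boxes of volume at least D³, while the three parts have
  -- volume at most C³ D³. So `complete∧empty⇒¬VDisc₃` applies with ratio C³.
  conflict⇒irregular : ∀ {C ε} (conflict : Conflict 𝓟 H f D) → let open Conflict conflict in
    ∀ {l U} → l ≢ i → l ≢ j → U ⊆ part 𝓟 l → D ≤ ∣ U ∣ → (∀ {v} → v ∈ U → ∃ λ u → f u ≡ v) →
    1 ≤ D → (∀ i → ∣ part 𝓟 i ∣ ≤ C * D) → 0ℚ ℚ.< ε → ε ℚ.* ⟦ C * C * C ⟧ ℚ.< ½ →
    ¬ VDisc₃ ε (part 𝓟 l) (part 𝓟 i) (part 𝓟 j) (H ∩ K₃[ part 𝓟 l , part 𝓟 i , part 𝓟 j ])
  conflict⇒irregular {C} {ε} conflict {l} {U} l≢i l≢j U⊆l D≤U U⊆f 1≤D ∣part∣≤CD ε>0 εC³<½ =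
    complete∧empty⇒¬VDisc₃ {ε = ε} {C * C * C} {D * D * D} {X} {Y} {Z} {U} {V} {W} {U} {V′} {W′}
      (H ∩ K₃[ X , Y , Z ]) ε>0 εC³<½
      (ℕ.*-mono-≤ (ℕ.*-mono-≤ 1≤D 1≤D) 1≤D)
      (ℕ.≤-trans (ℕ.*-mono-≤ (ℕ.*-mono-≤ (∣part∣≤CD l) (∣part∣≤CD i)) (∣part∣≤CD j)) (ℕ.≤-reflexive [CD]³≡C³D³))
      U⊆l V⊆i W⊆j (ℕ.*-mono-≤ (ℕ.*-mono-≤ D≤U D≤V) D≤W)
      (λ {u} {v} {w} u∈ v∈ w∈ →
        let e = subst (λ u → T (edge H u v w)) (proj₂ (U⊆f u∈)) (complete v∈ w∈)
        in T-∧⁺ e (K₃-edge X Y Z (U⊆l u∈) (V⊆i v∈) (W⊆j w∈) (distinct H u v w e)))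
      U⊆l V′⊆i W′⊆j (ℕ.*-mono-≤ (ℕ.*-mono-≤ D≤U D≤V′) D≤W′)
      (λ {u} {v} {w} u∈ v∈ w∈ e →
        empty v∈ w∈ (subst (λ u → T (edge H u v w)) (sym (proj₂ (U⊆f u∈)))
          (proj₁ (T-∧⁻ {edge H u v w} e))))
    where
    open Conflict conflict

    X = part 𝓟 l
    Y = part 𝓟 i
    Z = part 𝓟 j

    [CD]³≡C³D³ : C * D * (C * D) * (C * D) ≡ C * C * C * (D * D * D)
    [CD]³≡C³D³ = trans (cong (_* (C * D)) (ℕ.[m*n]*[o*p]≡[m*o]*[n*p] C D C D))
                       (ℕ.[m*n]*[o*p]≡[m*o]*[n*p] (C * C) (D * D) C D)

  irregularTriple : ∀ {S C ε} → (∀ i → ∣ part 𝓟 i ∣ ≤ S) → 1 ≤ D → S ≤ C * D →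
    4 * (t * D) + S < k → t * D + (S + S) < k → 0ℚ ℚ.< ε → ε ℚ.* ⟦ C * C * C ⟧ ℚ.< ½ →
    ∃ λ l → ∃ λ i → ∃ λ j → Distinct l i j ×
    ¬ VDisc₃ ε (part 𝓟 l) (part 𝓟 i) (part 𝓟 j) (H ∩ K₃[ part 𝓟 l , part 𝓟 i , part 𝓟 j ])
  irregularTriple {C = C} ∣part∣≤S 1≤D S≤CD 4tD+S<k tD+2S<k ε>0 εC³<½ =
    let conflict = ∃conflict ∣part∣≤S 4tD+S<k
        open Conflict conflict
        l , l≢i , l≢j , U , U⊆l , D≤U , U⊆f = largeImagePart ∣part∣≤S tD+2S<k i j
    in l , i , j , (l≢i , i≢j , l≢j) ,
       conflict⇒irregular {C} conflict l≢i l≢j U⊆l D≤U U⊆f 1≤D (λ i → ℕ.≤-trans (∣part∣≤S i) S≤CD) ε>0 εC³<½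

-- Part sizes and numerical constants

record Sizes (𝓟 : Equipartition n t) (k : ℕ) : Set where
  field
    D S       : ℕ
    ∣part∣≤S  : ∀ i → ∣ part 𝓟 i ∣ ≤ S
    1≤D       : 1 ≤ D
    S≤49D     : S ≤ 49 * D
    4tD+S<k   : 4 * (t * D) + S < k
    tD+2S<k   : t * D + (S + S) < k

-- Every part has s, s + 1 or s + 2 elements. Since t * s ≤ n ≤ 3 * k and t ≥ 24, both
-- t * D ≤ k / 8 and s ≤ k / 8 for D = s / 24, and t * 26 ≤ k forces s ≥ 24, whence s + 2 ≤ 49 * D.
sizes : (𝓟 : Equipartition n t) → 24 ≤ t → k ≤ n → n ≤ k + (k + k) → t * 26 ≤ k → Sizes 𝓟 k
sizes {n} {t@(suc _)} {k} 𝓟 24≤t k≤n n≤3k 26t≤k = record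
  { D = D ; S = s + 2
  ; ∣part∣≤S = ∣part∣≤s+2
  ; 1≤D = 1≤D
  ; S≤49D = S≤49D
  ; 4tD+S<k = ℕ.*-cancelˡ-< 24 _ _ 24[4tD+S]<24k
  ; tD+2S<k = ℕ.*-cancelˡ-< 24 _ _ 24[tD+2S]<24k
  }
  where
  open ℕ.≤-Reasoning
  open +-*-Solver
  -- Balance lets another part be smaller than this one by one, so subtracting one gives a lower
  -- bound valid for all parts.
  s = ∣ part 𝓟 zero ∣ ∸ 1
  D = s / 24

  s≤∣part∣ : ∀ i → s ≤ ∣ part 𝓟 i ∣
  s≤∣part∣ i = ℕ.m≤n+o⇒m∸n≤o _ 1 (balanced 𝓟 zero i)

  ∣part∣≤s+2 : ∀ i → ∣ part 𝓟 i ∣ ≤ s + 2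
  ∣part∣≤s+2 i = begin
    ∣ part 𝓟 i ∣           ≤⟨ balanced 𝓟 i zero ⟩
    suc ∣ part 𝓟 zero ∣    ≤⟨ s≤s (ℕ.m≤n+m∸n ∣ part 𝓟 zero ∣ 1) ⟩
    suc (suc s)            ≡⟨ ℕ.+-comm 2 s ⟩
    s + 2                  ∎

  26≤s+2 : 26 ≤ s + 2
  26≤s+2 = ℕ.*-cancelˡ-≤ t (begin
    t * 26       ≤⟨ 26t≤k ⟩
    k            ≤⟨ k≤n ⟩
    n            ≤⟨ parts≤m⇒n≤t*m 𝓟 ∣part∣≤s+2 ⟩
    t * (s + 2)  ∎)

  1≤D : 1 ≤ D
  1≤D = m≥n⇒m/n>0 (ℕ.+-cancelʳ-≤ 2 24 s 26≤s+2)

  S≤49D : s + 2 ≤ 49 * D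
  S≤49D = begin
    s + 2                  ≡⟨ cong (_+ 2) (m≡m%n+[m/n]*n s 24) ⟩
    s % 24 + D * 24 + 2    ≤⟨ ℕ.+-monoˡ-≤ 2 (ℕ.+-monoˡ-≤ (D * 24) (s≤s⁻¹ (m%n<n s 24))) ⟩
    23 + D * 24 + 2        ≡⟨ solve 1 (λ D → con 23 :+ D :* con 24 :+ con 2 := con 25 :+ con 24 :* D) refl D ⟩
    -- The constant 25 is the largest remainder 23 plus 2; it is absorbed by `1≤D`, and 25 + 24
    -- gives the factor 49.
    25 * 1 + 24 * D        ≤⟨ ℕ.+-monoˡ-≤ (24 * D) (ℕ.*-monoʳ-≤ 25 1≤D) ⟩
    25 * D + 24 * D        ≡⟨ ℕ.*-distribʳ-+ D 25 24 ⟨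
    49 * D                 ∎

  ts≤3k : t * s ≤ 3 * k
  ts≤3k = ℕ.≤-trans (parts≥m⇒t*m≤n 𝓟 s≤∣part∣)
    (ℕ.≤-trans n≤3k (ℕ.≤-reflexive (cong (λ x → k + (k + x)) (sym (ℕ.+-identityʳ k)))))

  24tD≤3k : 24 * (t * D) ≤ 3 * k
  24tD≤3k = begin
    24 * (t * D)  ≡⟨ solve 2 (λ t D → con 24 :* (t :* D) := t :* (D :* con 24)) refl t D ⟩
    t * (D * 24)  ≤⟨ ℕ.*-monoʳ-≤ t (m/n*n≤m s 24) ⟩
    t * s         ≤⟨ ts≤3k ⟩
    3 * k         ∎

  24s≤3k : 24 * s ≤ 3 * k
  24s≤3k = ℕ.≤-trans (ℕ.*-monoˡ-≤ s 24≤t) ts≤3k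

  26≤k : 26 ≤ k
  26≤k = ℕ.≤-trans (ℕ.*-monoˡ-≤ 26 {1} {t} (s≤s z≤n)) 26t≤k

  24[4tD+S]<24k : 24 * (4 * (t * D) + (s + 2)) < 24 * k
  24[4tD+S]<24k = begin-strict
    24 * (4 * (t * D) + (s + 2))
      ≡⟨ solve 2 (λ x s → con 24 :* (con 4 :* x :+ (s :+ con 2)) := con 4 :* (con 24 :* x) :+ con 24 :* s :+ con 48) refl (t * D) s ⟩
    4 * (24 * (t * D)) + 24 * s + 48
      ≤⟨ ℕ.+-monoˡ-≤ 48 (ℕ.+-mono-≤ (ℕ.*-monoʳ-≤ 4 24tD≤3k) 24s≤3k) ⟩
    4 * (3 * k) + 3 * k + 48
      -- Of 24 k, the main terms use 15 k; the remaining 9 k exceeds 48 because k ≥ 26.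
      <⟨ ℕ.+-monoʳ-< (4 * (3 * k) + 3 * k) {48} {9 * 26} (toWitness {a? = 48 ℕ.<? 9 * 26} _) ⟩
    4 * (3 * k) + 3 * k + 9 * 26
      ≤⟨ ℕ.+-monoʳ-≤ (4 * (3 * k) + 3 * k) (ℕ.*-monoʳ-≤ 9 26≤k) ⟩
    4 * (3 * k) + 3 * k + 9 * k
      ≡⟨ solve 1 (λ k → con 4 :* (con 3 :* k) :+ con 3 :* k :+ con 9 :* k := con 24 :* k) refl k ⟩
    24 * k ∎

  24[tD+2S]<24k : 24 * (t * D + ((s + 2) + (s + 2))) < 24 * k
  24[tD+2S]<24k = begin-strict
    24 * (t * D + ((s + 2) + (s + 2)))
      ≡⟨ solve 2 (λ x s → con 24 :* (x :+ ((s :+ con 2) :+ (s :+ con 2))) := con 24 :* x :+ con 2 :* (con 24 :* s) :+ con 96) refl (t * D) s ⟩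
    24 * (t * D) + 2 * (24 * s) + 96
      ≤⟨ ℕ.+-monoˡ-≤ 96 (ℕ.+-mono-≤ 24tD≤3k (ℕ.*-monoʳ-≤ 2 24s≤3k)) ⟩
    3 * k + 2 * (3 * k) + 96
      -- Here the main terms use 9 k, and the remaining 15 k exceeds 96.
      <⟨ ℕ.+-monoʳ-< (3 * k + 2 * (3 * k)) {96} {15 * 26} (toWitness {a? = 96 ℕ.<? 15 * 26} _) ⟩
    3 * k + 2 * (3 * k) + 15 * 26
      ≤⟨ ℕ.+-monoʳ-≤ (3 * k + 2 * (3 * k)) (ℕ.*-monoʳ-≤ 15 26≤k) ⟩
    3 * k + 2 * (3 * k) + 15 * k
      ≡⟨ solve 1 (λ k → con 3 :* k :+ con 2 :* (con 3 :* k) :+ con 15 :* k := con 24 :* k) refl k ⟩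
    24 * k ∎

-- Irregular triples for every fine equipartition of a large half graph

halfGraph⇒irregular : ∀ {H : Graph₃ (Fin n)} {ε} → HalfGraph k H → (𝓟 : Equipartition n t) →
  24 ≤ t → n ≤ k + (k + k) → t * 26 ≤ k → 0ℚ ℚ.< ε → ε ℚ.* ⟦ 49 * 49 * 49 ⟧ ℚ.< ½ →
  ∃ λ l → ∃ λ i → ∃ λ j → Distinct l i j ×
  ¬ VDisc₃ ε (part 𝓟 l) (part 𝓟 i) (part 𝓟 j) (H ∩ K₃[ part 𝓟 l , part 𝓟 i , part 𝓟 j ])
halfGraph⇒irregular halfGraph 𝓟 24≤t n≤3k 26t≤k ε>0 ε49³<½ =
  irregularTriple halfGraph 𝓟 D {S} {49} ∣part∣≤S 1≤D S≤49D 4tD+S<k tD+2S<k ε>0 ε49³<½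
  where open Sizes (sizes 𝓟 24≤t (injective⇒≤ (HalfGraph.f-injective halfGraph)) n≤3k 26t≤k)

theorem2p39 : ∀ {ℓ : Level} (𝓗 : Property ℓ) → Hereditary 𝓗 →
    (∀ (k : ℕ) → 1 ≤ k → H̄ k ∈Trip 𝓗) →
    ¬ AdmitsZeroVDisc₃Error 𝓗
theorem2p39 𝓗 hereditary H̄∈Trip zeroError =
  -- Every part has at most 49 D vertices, hence the cube as ratio of the volumes.
  case smallerThan½/⟦ 49 * 49 * 49 ⟧ (s≤s z≤n) of λ (ε , ε>0 , ε49³<½) →
  case zeroError ε 24 ε>0 (s≤s z≤n) of λ (T₀ , N , regularise) →
  -- The size of the half graph is chosen after `T₀` and `N`: it exceeds `N`, and `n` is at least
  -- this size as `f` is injective; it also exceeds `T₀ * 26`, which bounds `t * 26`. The successor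
  -- makes it positive.
  case smallHalfGraph 𝓗 hereditary (H̄∈Trip (suc (N + T₀ * 26)) (s≤s z≤n)) of λ (n , H , H∈𝓗 , halfGraph , n≤3k) →
  let N≤n = ℕ.≤-trans (ℕ.m≤n⇒m≤1+n (ℕ.m≤m+n N (T₀ * 26))) (injective⇒≤ (HalfGraph.f-injective halfGraph)) in
  case regularise n H H∈𝓗 N≤n of λ (t , 24≤t , t≤T₀ , 𝓟 , regular) →
  let 26t≤k = ℕ.≤-trans (ℕ.*-monoˡ-≤ 26 t≤T₀) (ℕ.m≤n⇒m≤1+n (ℕ.m≤n+m (T₀ * 26) N)) in
  case halfGraph⇒irregular halfGraph 𝓟 24≤t n≤3k 26t≤k ε>0 ε49³<½ of λ (l , i , j , l≢i≢j , irregular) →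
  irregular (regular l i j l≢i≢j)
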